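{- Let $M(p)=\#\{q_p(u) : 0\le u\le p-1\}$ be the size of the image of the map $u\mapsto q_p(u)$ on $\{0,\ldots,p-1\}$. Then $$M(p)\ge (1+o(1))\frac{p}{(\log p)^2}$$ as $p\to\infty$ over primes.
   Context: For a prime $p$ and an integer $u$ with $\gcd(u,p)=1$, the Fermat quotient $q_p(u)$ is the unique integer with $q_p(u)\equiv (u^{p-1}-1)/p \pmod p$ and $0\le q_p(u)\le p-1$; also $q_p(kp)=0$ for all $k\in\mathbb Z$. -}

module Defs where

open import Data.Nat using (ℕ; zero; suc; _+_; _*_; _∸_; _^_; _≤_; _<_; NonZero; _!)
open import Data.Nat.DivMod using (_/_; _%_)
open import Data.Nat.Properties using (_≟_; _!≢0)
open import Data.List using (List; length; map; upTo; deduplicate)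
open import Data.Nat.ListAction using (sum)

-- Fermat quotient q_p(u) for 0 ≤ u ≤ p-1 (p prime).
-- For u = 0 (a multiple of p) it is 0 by convention.
-- For 1 ≤ u ≤ p-1, p divides u^(p-1) - 1 (Fermat), so the floor division
-- below is exact, and reducing mod p gives the unique representative in [0, p-1].
fermatQuotient : (p : ℕ) → .{{NonZero p}} → ℕ → ℕ
fermatQuotient p zero    = 0
fermatQuotient p (suc v) = ((suc v ^ (p ∸ 1) ∸ 1) / p) % p

M : (p : ℕ) → .{{NonZero p}} → ℕ
M p = length (deduplicate _≟_ (map (fermatQuotient p) (upTo p)))

-- N! * Σ_{k=0}^{N} a^k / k!   (a natural number: scaled N-th Taylor partial sum of e^a)
expPartialScaled : ℕ → ℕ → ℕ
expPartialScaled a N = sum (map (λ k → a ^ k * _/_ (N !) (k !) {{k !≢0}}) (upTo (suc N)))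

-- "a/b ≤ ln x" for naturals a, b (b > 0), x:  e^(a/b) ≤ x  ⇔  e^a ≤ x^b
-- ⇔  every Taylor partial sum of e^a is ≤ x^b.
LogLowerBound : ℕ → ℕ → ℕ → Set
LogLowerBound a b x = ∀ N → expPartialScaled a N ≤ x ^ b * N !

{-# OPTIONS --safe #-}

-- If q(u) = q(v) and q(u′) = q(v′) with u/v ≡ u′/v′ modulo p, then u/v ≡ u′/v′ already modulo p², because
-- both ratios are (p-1)-st roots of unity there; as all numbers are below p, this forces u v′ = u′ v.  The
-- pairs with q(u) = q(v) therefore fall into at most p classes of proportional pairs, and
-- Cauchy–Schwarz over the fibres of q bounds the image from below.
--
-- Applied to the primes below p this needs π(p) ~ p / log p.  The prime number theorem is avoided by using
-- also small multiples of primes: a prime l with j = min(9, ⌊(p-1)/l⌋) contributes l, 2l, …, jl, each with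
-- weight about 1/√j.  A class then still has weight at most 1, while the total weight is about
-- Σ_j (√j - √(j-1)) π(p/j), a gain of more than 3/2 over π(p).  This makes up for the loss in Chebyshev's bound
-- π(x) ≥ (log 2 + o(1)) x / log x, since (3/2) log 2 > 1, i.e. e² < 8.

module Submission where

open import Defs
open import Data.Empty using (⊥)
open import Data.List using (List; []; _∷_; _++_; _∷ʳ_; length; map; upTo; concatMap; filter; deduplicate)
open import Data.List.Membership.Propositional using (_∈_; find)
open import Data.List.Membership.Propositional.Properties using (∈-upTo⁻; ∈-upTo⁺; ∈-filter⁻; ∈-concatMap⁻; ∈-map⁻; ∈-map⁺; ∈-deduplicate⁺)
open import Data.List.Properties using (upTo-∷ʳ; map-++; length-upTo; map-applyUpTo)
open import Data.List.Relation.Unary.All as All using (_∷_)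
open import Data.List.Relation.Unary.AllPairs using (_∷_)
open import Data.List.Relation.Unary.Any using (here; there)
open import Data.List.Relation.Unary.Unique.Propositional using (Unique)
open import Data.Nat
open import Data.Nat.DivMod using (*-/-assoc; n/n≡1; m≡m%n+[m/n]*n; [m+kn]%n≡m%n; m<n⇒m%n≡m; m*n/n≡m; m%n<n; m/n*n≤m)
open import Data.Nat.Divisibility
open import Data.Nat.ListAction using (sum; product)
open import Data.Nat.ListAction.Properties using (sum-++)
open import Data.Nat.Primality using (Prime; prime?; prime⇒nonZero; prime⇒nonTrivial; prime⇒irreducible; euclidsLemma)
open import Data.Nat.Primality.Factorisation using (factorise)
open import Data.Nat.Properties
open import Data.Nat.Tactic.RingSolver using (solve-∀)
open import Data.List.Relation.Unary.Unique.DecPropositional.Properties _≟_ using (upTo⁺; filter⁺; deduplicate-!)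
open import Data.Product using (_×_; _,_; ∃-syntax; proj₁; proj₂)
open import Data.Sum using (_⊎_; inj₁; inj₂; [_,_]′)
open import Relation.Binary.PropositionalEquality
open import Relation.Nullary using (¬_; Dec; yes; no; contradiction)
open import Relation.Nullary.Decidable using (_×-dec_; ¬?; toWitness)

-- A class has weight at most 1 because it meets a single pair of primes (l, l′), by unique
-- factorisation, and inside it m/m′ is fixed: it holds at most min(j, j′) pairs (ml, m′l′), each of
-- weight 1/√(jj′). Pairs of multiples of one prime escape this argument, since ml/(m′l) forgets l;
-- they are counted apart and contribute only a multiple of the total weight. Primes up to 9 are
-- dropped so that no prime divides a cofactor. All inequalities are kept in ℕ. Weights are scaled
-- by 18 and rounded down, so a class weighs at most 18² = 324. Logarithms are taken to base 2, with
-- L = ⌊log₂ p⌋: Chebyshev's bound comes from common multiples of 1, ..., n+1, which are at least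
-- 2^n, and e² ≤ 8 gives 2L/3 ≤ log p, so the target is 9p ≤ 4L²M(p). It needs total weight 27p/L,
-- and the rounded weights give 27.05p/(L+1) up to O(1). This thin margin pays for all lower-order
-- terms and is the reason for the large threshold 2^60187.

private variable
  A B : Set

-- Finite sums

∑ : List A → (A → ℕ) → ℕ
∑ xs f = sum (map f xs)

∑-mono : ∀ (xs : List A) {f g} → (∀ {x} → x ∈ xs → f x ≤ g x) → ∑ xs f ≤ ∑ xs g
∑-mono []       h = z≤n
∑-mono (x ∷ xs) h = +-mono-≤ (h (here refl)) (∑-mono xs (λ m → h (there m)))

∑-cong : ∀ (xs : List A) {f g} → (∀ x → f x ≡ g x) → ∑ xs f ≡ ∑ xs g
∑-cong []       h = refl
∑-cong (x ∷ xs) h = cong₂ _+_ (h x) (∑-cong xs h)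

∑-+ : ∀ (xs : List A) f g → ∑ xs (λ x → f x + g x) ≡ ∑ xs f + ∑ xs g
∑-+ []       f g = refl
∑-+ (x ∷ xs) f g = trans (cong (f x + g x +_) (∑-+ xs f g)) (interchange (f x) (g x) _ _)
  where
  interchange : ∀ a b c d → a + b + (c + d) ≡ a + c + (b + d)
  interchange = solve-∀

∑-*ˡ : ∀ (xs : List A) c f → ∑ xs (λ x → c * f x) ≡ c * ∑ xs f
∑-*ˡ []       c f = sym (*-zeroʳ c)
∑-*ˡ (x ∷ xs) c f = trans (cong (c * f x +_) (∑-*ˡ xs c f)) (sym (*-distribˡ-+ c (f x) _))

∑-*ʳ : ∀ (xs : List A) c f → ∑ xs (λ x → f x * c) ≡ ∑ xs f * c
∑-*ʳ xs c f = trans (∑-cong xs (λ x → *-comm (f x) c)) (trans (∑-*ˡ xs c f) (*-comm c _))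

∑-const : ∀ (xs : List A) c → ∑ xs (λ _ → c) ≡ length xs * c
∑-const []       c = refl
∑-const (x ∷ xs) c = cong (c +_) (∑-const xs c)

∑-upTo-const : ∀ n c → ∑ (upTo n) (λ _ → c) ≡ n * c
∑-upTo-const n c = trans (∑-const (upTo n) c) (cong (_* c) (length-upTo n))

∑-swap : ∀ (xs : List A) (ys : List B) (f : A → B → ℕ) →
         ∑ xs (λ x → ∑ ys (f x)) ≡ ∑ ys (λ y → ∑ xs (λ x → f x y))
∑-swap []       ys f = sym (trans (∑-const ys 0) (*-zeroʳ (length ys)))
∑-swap (x ∷ xs) ys f =
  trans (cong (∑ ys (f x) +_) (∑-swap xs ys f)) (sym (∑-+ ys (f x) _))

∑-++ : ∀ (xs ys : List A) f → ∑ (xs ++ ys) f ≡ ∑ xs f + ∑ ys f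
∑-++ xs ys f = trans (cong sum (map-++ f xs ys)) (sum-++ (map f xs) (map f ys))

∑-map : ∀ (xs : List A) (g : A → B) f → ∑ (map g xs) f ≡ ∑ xs (λ x → f (g x))
∑-map []       g f = refl
∑-map (x ∷ xs) g f = cong (f (g x) +_) (∑-map xs g f)

∑-concatMap : ∀ (xs : List A) (g : A → List B) f →
              ∑ (concatMap g xs) f ≡ ∑ xs (λ x → ∑ (g x) f)
∑-concatMap []       g f = refl
∑-concatMap (x ∷ xs) g f =
  trans (∑-++ (g x) _ f) (cong (∑ (g x) f +_) (∑-concatMap xs g f))

∑-upTo-suc : ∀ n f → ∑ (upTo (suc n)) f ≡ ∑ (upTo n) f + f n
∑-upTo-suc n f = begin
  ∑ (upTo (suc n)) f      ≡⟨ cong (λ xs → ∑ xs f) (sym (upTo-∷ʳ n)) ⟩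
  ∑ (upTo n ∷ʳ n) f       ≡⟨ ∑-++ (upTo n) (n ∷ []) f ⟩
  ∑ (upTo n) f + (f n + 0) ≡⟨ cong (∑ (upTo n) f +_) (+-identityʳ (f n)) ⟩
  ∑ (upTo n) f + f n      ∎
  where open ≡-Reasoning

term≤∑ : ∀ (xs : List A) f {x} → x ∈ xs → f x ≤ ∑ xs f
term≤∑ (x ∷ xs) f (here refl) = m≤m+n (f x) _
term≤∑ (y ∷ xs) f (there m)   = ≤-trans (term≤∑ xs f m) (m≤n+m _ (f y))

∑-positive⁻ : ∀ (xs : List A) f → 0 < ∑ xs f → ∃[ x ] (x ∈ xs × 0 < f x)
∑-positive⁻ (x ∷ xs) f pos with f x in eq
... | suc k = x , here refl , subst (0 <_) (sym eq) z<s
... | zero with ∑-positive⁻ xs f pos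
...   | y , y∈ , q = y , there y∈ , q

-- Every uniqueness statement below (one fibre per pair, one cofactor per row, one block per class)
-- becomes a bound on a sum through this lemma.
∑-atMostOne : ∀ {xs : List A} {f} {R} → Unique xs → (∀ {x} → x ∈ xs → f x ≤ R) →
              (∀ {x y} → x ∈ xs → y ∈ xs → 0 < f x → 0 < f y → x ≡ y) → ∑ xs f ≤ R
∑-atMostOne {xs = []}             _        bound one = z≤n
∑-atMostOne {xs = x ∷ xs} {f} {R} (x∉ ∷ u) bound one with ∑ xs f in eq
... | zero  = subst (_≤ R) (sym (+-identityʳ (f x))) (bound (here refl))
... | suc k with ∑-positive⁻ xs f (subst (0 <_) (sym eq) z<s) | f x in fx
...   | y , y∈ , fy | suc _ =
        contradiction (one (here refl) (there y∈) (subst (0 <_) (sym fx) z<s) fy) (All.lookup x∉ y∈)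
...   | _ | zero = subst (_≤ R) eq (∑-atMostOne u (λ m → bound (there m)) (λ a b → one (there a) (there b)))

𝟙 : Dec A → ℕ
𝟙 (yes _) = 1
𝟙 (no  _) = 0

𝟙≤1 : (d : Dec A) → 𝟙 d ≤ 1
𝟙≤1 (yes _) = ≤-refl
𝟙≤1 (no  _) = z≤n

𝟙-true : (d : Dec A) → A → 𝟙 d ≡ 1
𝟙-true (yes _) a = refl
𝟙-true (no ¬a) a = contradiction a ¬a

𝟙-positive⁻ : (d : Dec A) → 0 < 𝟙 d → A
𝟙-positive⁻ (yes a) _ = a

0<*⇒0<ˡ : ∀ m {n} → 0 < m * n → 0 < m
0<*⇒0<ˡ (suc m) _ = z<s

2xy≤x²+y² : ∀ x y → 2 * (x * y) ≤ x * x + y * y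
2xy≤x²+y² x y with ≤-total x y
... | inj₁ x≤y = subst (λ z → 2 * (x * z) ≤ x * x + z * z) (m+[n∸m]≡n x≤y)
                   (≤-trans (m≤m+n _ _) (≤-reflexive (square x (y ∸ x))))
  where
  square : ∀ x d → 2 * (x * (x + d)) + d * d ≡ x * x + (x + d) * (x + d)
  square = solve-∀
... | inj₂ y≤x = subst (λ z → 2 * (z * y) ≤ z * z + y * y) (m+[n∸m]≡n y≤x)
                   (≤-trans (m≤m+n _ _) (≤-reflexive (square y (x ∸ y))))
  where
  square : ∀ y d → 2 * ((y + d) * y) + d * d ≡ (y + d) * (y + d) + y * y
  square = solve-∀

-- Cauchy–Schwarz for the fibres of v, linearised by a free parameter t so that no division by the
-- energy is needed.
fibre-energy : ∀ (I : List A) (W v : A → ℕ) (V : List ℕ) → Unique V → (∀ {i} → i ∈ I → v i ∈ V) → ∀ t →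
  2 * (t * ∑ I W) ≤ length V * (t * t) + ∑ I (λ i → ∑ I (λ j → 𝟙 (v i ≟ v j) * (W i * W j)))
fibre-energy I W v V uniq v∈V t = begin
  2 * (t * ∑ I W)                       ≤⟨ *-monoʳ-≤ 2 (*-monoʳ-≤ t total) ⟩
  2 * (t * ∑ V F)                       ≡⟨ cong (2 *_) (sym (∑-*ˡ V t F)) ⟩
  2 * ∑ V (λ a → t * F a)               ≡⟨ sym (∑-*ˡ V 2 _) ⟩
  ∑ V (λ a → 2 * (t * F a))             ≤⟨ ∑-mono V (λ {a} _ → 2xy≤x²+y² t (F a)) ⟩
  ∑ V (λ a → t * t + F a * F a)         ≡⟨ ∑-+ V _ _ ⟩
  ∑ V (λ _ → t * t) + ∑ V (λ a → F a * F a)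
                                        ≤⟨ +-mono-≤ (≤-reflexive (∑-const V (t * t))) energy ⟩
  length V * (t * t) + ∑ I (λ i → ∑ I (λ j → 𝟙 (v i ≟ v j) * (W i * W j))) ∎
  where
  open ≤-Reasoning
  F : ℕ → ℕ
  F a = ∑ I (λ i → 𝟙 (v i ≟ a) * W i)

  total : ∑ I W ≤ ∑ V F
  total = begin
    ∑ I W                                       ≤⟨ ∑-mono I step ⟩
    ∑ I (λ i → ∑ V (λ a → 𝟙 (v i ≟ a) * W i))   ≡⟨ ∑-swap I V _ ⟩
    ∑ V F                                       ∎
    where
    step : ∀ {i} → i ∈ I → W i ≤ ∑ V (λ a → 𝟙 (v i ≟ a) * W i)
    step {i} i∈ = begin
      W i                                ≡⟨ sym (*-identityˡ (W i)) ⟩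
      1 * W i                            ≡⟨ cong (_* W i) (sym (𝟙-true (v i ≟ v i) refl)) ⟩
      𝟙 (v i ≟ v i) * W i                ≤⟨ term≤∑ V (λ a → 𝟙 (v i ≟ a) * W i) (v∈V i∈) ⟩
      ∑ V (λ a → 𝟙 (v i ≟ a) * W i)      ∎

  square : ∀ a → F a * F a ≡ ∑ I (λ i → ∑ I (λ j → (𝟙 (v i ≟ a) * W i) * (𝟙 (v j ≟ a) * W j)))
  square a = trans (sym (∑-*ʳ I (F a) _)) (∑-cong I (λ i → sym (∑-*ˡ I (𝟙 (v i ≟ a) * W i) _)))

  -- At most one a can equal both v i and v j, so the sum over V has at most one nonzero term.
  pair : ∀ i j → ∑ V (λ a → (𝟙 (v i ≟ a) * W i) * (𝟙 (v j ≟ a) * W j)) ≤ 𝟙 (v i ≟ v j) * (W i * W j)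
  pair i j = ∑-atMostOne uniq bound (λ {a} {b} _ _ pa pb → trans (sym (hit a pa)) (hit b pb))
    where
    hit : ∀ a → 0 < (𝟙 (v i ≟ a) * W i) * (𝟙 (v j ≟ a) * W j) → v i ≡ a
    hit a pos = 𝟙-positive⁻ (v i ≟ a) (0<*⇒0<ˡ _ (0<*⇒0<ˡ _ pos))
    bound : ∀ {a} → a ∈ V → (𝟙 (v i ≟ a) * W i) * (𝟙 (v j ≟ a) * W j) ≤ 𝟙 (v i ≟ v j) * (W i * W j)
    bound {a} _ with v i ≟ a | v j ≟ a
    ... | no _  | _    = z≤n
    ... | yes _ | no _ = ≤-trans (≤-reflexive (*-zeroʳ (1 * W i))) z≤n
    ... | yes x | yes y = ≤-reflexive (trans (cong₂ _*_ (*-identityˡ (W i)) (*-identityˡ (W j)))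
                            (trans (sym (*-identityˡ _)) (cong (_* (W i * W j)) (sym (𝟙-true (v i ≟ v j) (trans x (sym y)))))))

  energy : ∑ V (λ a → F a * F a) ≤ ∑ I (λ i → ∑ I (λ j → 𝟙 (v i ≟ v j) * (W i * W j)))
  energy = begin
    ∑ V (λ a → F a * F a)
      ≡⟨ ∑-cong V square ⟩
    ∑ V (λ a → ∑ I (λ i → ∑ I (λ j → (𝟙 (v i ≟ a) * W i) * (𝟙 (v j ≟ a) * W j))))
      ≡⟨ ∑-swap V I _ ⟩
    ∑ I (λ i → ∑ V (λ a → ∑ I (λ j → (𝟙 (v i ≟ a) * W i) * (𝟙 (v j ≟ a) * W j))))
      ≡⟨ ∑-cong I (λ i → ∑-swap V I _) ⟩
    ∑ I (λ i → ∑ I (λ j → ∑ V (λ a → (𝟙 (v i ≟ a) * W i) * (𝟙 (v j ≟ a) * W j))))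
      ≤⟨ ∑-mono I (λ {i} _ → ∑-mono I (λ {j} _ → pair i j)) ⟩
    ∑ I (λ i → ∑ I (λ j → 𝟙 (v i ≟ v j) * (W i * W j))) ∎

-- The exponential

^-distribʳ-* : ∀ n x y → (x * y) ^ n ≡ x ^ n * y ^ n
^-distribʳ-* zero    x y = refl
^-distribʳ-* (suc n) x y = trans (cong (x * y *_) (^-distribʳ-* n x y)) (interchange x y (x ^ n) (y ^ n))
  where
  interchange : ∀ a b c d → a * b * (c * d) ≡ a * c * (b * d)
  interchange = solve-∀

-- cⁿ n! Σ_{k≤n} (i/c)ᵏ/k!, the scaled Taylor polynomial of e^(i/c).
expPartialFrac : ℕ → ℕ → ℕ → ℕ
expPartialFrac c i zero    = 1
expPartialFrac c i (suc n) = c * suc n * expPartialFrac c i n + i ^ suc n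

-- Since k! divides n! for k ≤ n, the floor divisions are exact and every old term grows by the
-- factor n + 1. This is the recurrence that defines `expPartialFrac`, with c = 1.
expPartialScaled-suc : ∀ a n → expPartialScaled a (suc n) ≡ suc n * expPartialScaled a n + a ^ suc n
expPartialScaled-suc a n = begin
  ∑ (upTo (suc (suc n))) (term (suc n))                      ≡⟨ ∑-upTo-suc (suc n) (term (suc n)) ⟩
  ∑ (upTo (suc n)) (term (suc n)) + term (suc n) (suc n)     ≡⟨ cong₂ _+_ scale last ⟩
  suc n * ∑ (upTo (suc n)) (term n) + a ^ suc n              ∎
  where
  open ≡-Reasoning
  term : ℕ → ℕ → ℕ
  term m k = a ^ k * _/_ (m !) (k !) {{k !≢0}}
  ∑-cong∈ : ∀ {f g : ℕ → ℕ} xs → (∀ {x} → x ∈ xs → f x ≡ g x) → ∑ xs f ≡ ∑ xs g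
  ∑-cong∈ xs h = ≤-antisym (∑-mono xs (λ m → ≤-reflexive (h m))) (∑-mono xs (λ m → ≤-reflexive (sym (h m))))
  last : term (suc n) (suc n) ≡ a ^ suc n
  last = trans (cong (a ^ suc n *_) (n/n≡1 (suc n !) {{suc n !≢0}})) (*-identityʳ _)
  commute : ∀ x y z → x * (y * z) ≡ y * (x * z)
  commute = solve-∀
  scale : ∑ (upTo (suc n)) (term (suc n)) ≡ suc n * ∑ (upTo (suc n)) (term n)
  scale = trans (∑-cong∈ (upTo (suc n)) λ {k} k∈ →
            trans (cong (a ^ k *_) (*-/-assoc (suc n) {{k !≢0}} (m≤n⇒m!∣n! (≤-pred (∈-upTo⁻ k∈)))))
                  (commute (a ^ k) (suc n) _))
          (∑-*ˡ (upTo (suc n)) (suc n) (term n))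

expPartialFrac-scaled : ∀ c a n → expPartialFrac c (c * a) n ≡ c ^ n * expPartialScaled a n
expPartialFrac-scaled c a zero    = refl
expPartialFrac-scaled c a (suc n) = begin
  c * suc n * expPartialFrac c (c * a) n + (c * a) ^ suc n
    ≡⟨ cong₂ (λ x y → c * suc n * x + y) (expPartialFrac-scaled c a n) (^-distribʳ-* (suc n) c a) ⟩
  c * suc n * (c ^ n * expPartialScaled a n) + c ^ suc n * a ^ suc n
    ≡⟨ regroup c (suc n) (c ^ n) (expPartialScaled a n) (a ^ suc n) ⟩
  c ^ suc n * (suc n * expPartialScaled a n + a ^ suc n)
    ≡⟨ cong (c ^ suc n *_) (sym (expPartialScaled-suc a n)) ⟩
  c ^ suc n * expPartialScaled a (suc n) ∎
  where
  open ≡-Reasoning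
  regroup : ∀ c s x e y → c * s * (x * e) + c * x * y ≡ c * x * (s * e + y)
  regroup = solve-∀

-- Mean value inequality for x^(n+1) on [i, i + 1]: the derivative is largest at the right end.
suc^-bound : ∀ i n → suc i ^ suc n ≤ i ^ suc n + suc n * suc i ^ n
suc^-bound i zero = ≤-reflexive (base i)
  where
  base : ∀ i → (1 + i) * 1 ≡ i * 1 + 1
  base = solve-∀
suc^-bound i (suc n) = begin
  suc i * suc i ^ suc n                                   ≡⟨⟩
  suc i ^ suc n + i * suc i ^ suc n                       ≤⟨ +-monoʳ-≤ (suc i ^ suc n) (*-monoʳ-≤ i (suc^-bound i n)) ⟩
  suc i ^ suc n + i * (i ^ suc n + suc n * suc i ^ n)     ≡⟨ expand i (suc i ^ suc n) (i ^ suc n) (suc n) (suc i ^ n) ⟩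
  i ^ suc (suc n) + (suc i ^ suc n + suc n * (i * suc i ^ n))
    ≤⟨ +-monoʳ-≤ (i ^ suc (suc n)) (+-monoʳ-≤ (suc i ^ suc n) (*-monoʳ-≤ (suc n) (*-monoˡ-≤ (suc i ^ n) (n≤1+n i)))) ⟩
  i ^ suc (suc n) + (suc i ^ suc n + suc n * suc i ^ suc n) ∎
  where
  open ≤-Reasoning
  expand : ∀ i x y s z → x + i * (y + s * z) ≡ i * y + (x + s * (i * z))
  expand = solve-∀

-- The mean value inequality (1 - 1/c) T(x + 1/c) ≤ T(x) for the Taylor polynomial T.
expPartialFrac-step : ∀ c i n → c * expPartialFrac c (suc i) n + suc i ^ n ≤
                                c * expPartialFrac c i n + expPartialFrac c (suc i) n
expPartialFrac-step c i zero    = ≤-refl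
-- The derivative of a Taylor polynomial is the previous one, hence the induction hypothesis times
-- `c * s`; `suc^-bound` handles the top term. Adding `c * s * u` to both sides avoids subtraction.
expPartialFrac-step c i (suc n) = +-cancelʳ-≤ (c * s * u) _ _ (begin
  c * (c * s * H′ + suc i ^ suc n) + suc i ^ suc n + c * s * u
    ≡⟨ left c s H′ (suc i ^ suc n) u ⟩
  c * s * (c * H′ + u) + c * suc i ^ suc n + suc i ^ suc n
    ≤⟨ +-monoˡ-≤ (suc i ^ suc n) (+-mono-≤ (*-monoʳ-≤ (c * s) (expPartialFrac-step c i n))
                                           (*-monoʳ-≤ c (suc^-bound i n))) ⟩
  c * s * (c * H + H′) + c * (i ^ suc n + s * u) + suc i ^ suc n
    ≡⟨ right c s H H′ (i ^ suc n) u (suc i ^ suc n) ⟩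
  c * (c * s * H + i ^ suc n) + (c * s * H′ + suc i ^ suc n) + c * s * u ∎)
  where
  open ≤-Reasoning
  s u H H′ : ℕ
  s  = suc n
  u  = suc i ^ n
  H  = expPartialFrac c i n
  H′ = expPartialFrac c (suc i) n
  left : ∀ c s h x u → c * (c * s * h + x) + x + c * s * u ≡ c * s * (c * h + u) + c * x + x
  left = solve-∀
  right : ∀ c s h h′ y u x →
    c * s * (c * h + h′) + c * (y + s * u) + x ≡ c * (c * s * h + y) + (c * s * h′ + x) + c * s * u
  right = solve-∀

-- Descends from x = i/(c+1) to T(0) = 1 in i steps, each costing a factor (c+1)/c: the Taylor
-- polynomials of e^x are at most (1 + 1/c)^i.
expPartialFrac-bound : ∀ c i n → c ^ i * expPartialFrac (suc c) i n ≤ suc c ^ i * (suc c ^ n * n !)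
expPartialFrac-bound c zero n = ≤-reflexive (cong (1 *_) (at-zero n))
  where
  at-zero : ∀ n → expPartialFrac (suc c) 0 n ≡ suc c ^ n * n !
  at-zero zero    = refl
  at-zero (suc n) = trans (+-identityʳ _) (trans (cong (suc c * suc n *_) (at-zero n)) (regroup (suc c) (suc n) (suc c ^ n) (n !)))
    where
    regroup : ∀ c s x y → c * s * (x * y) ≡ c * x * (s * y)
    regroup = solve-∀
expPartialFrac-bound c (suc i) n = begin
  c * c ^ i * H′               ≡⟨ regroup c (c ^ i) H′ ⟩
  c ^ i * (c * H′)             ≤⟨ *-monoʳ-≤ (c ^ i) step ⟩
  c ^ i * (suc c * H)          ≡⟨ regroup′ (c ^ i) (suc c) H ⟩
  suc c * (c ^ i * H)          ≤⟨ *-monoʳ-≤ (suc c) (expPartialFrac-bound c i n) ⟩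
  suc c * (suc c ^ i * (suc c ^ n * n !)) ≡⟨ sym (*-assoc (suc c) (suc c ^ i) _) ⟩
  suc c * suc c ^ i * (suc c ^ n * n !) ∎
  where
  open ≤-Reasoning
  H H′ : ℕ
  H  = expPartialFrac (suc c) i n
  H′ = expPartialFrac (suc c) (suc i) n
  regroup : ∀ c x h → c * x * h ≡ x * (c * h)
  regroup = solve-∀
  regroup′ : ∀ x c h → x * (c * h) ≡ c * (x * h)
  regroup′ = solve-∀
  step : c * H′ ≤ suc c * H
  step = +-cancelʳ-≤ H′ _ _ (begin
    c * H′ + H′               ≡⟨ +-comm (c * H′) H′ ⟩
    suc c * H′                ≤⟨ m≤m+n _ (suc i ^ n) ⟩
    suc c * H′ + suc i ^ n    ≤⟨ expPartialFrac-step (suc c) i n ⟩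
    suc c * H + H′            ∎)

-- e² ≤ (15/14)³⁰ ≤ 8.
expPartialScaled-2* : ∀ L n → expPartialScaled (2 * L) n ≤ 8 ^ L * n !
expPartialScaled-2* L n = *-cancelˡ-≤ (14 ^ (15 * (2 * L)) * 15 ^ n) {{m*n≢0 (14 ^ (15 * (2 * L))) (15 ^ n) {{m^n≢0 14 (15 * (2 * L))}} {{m^n≢0 15 n}}}} (begin
  14 ^ i * 15 ^ n * expPartialScaled (2 * L) n   ≡⟨ *-assoc (14 ^ i) (15 ^ n) _ ⟩
  14 ^ i * (15 ^ n * expPartialScaled (2 * L) n) ≡⟨ cong (14 ^ i *_) (sym (expPartialFrac-scaled 15 (2 * L) n)) ⟩
  14 ^ i * expPartialFrac 15 i n                 ≤⟨ expPartialFrac-bound 14 i n ⟩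
  15 ^ i * (15 ^ n * n !)                        ≤⟨ *-monoˡ-≤ (15 ^ n * n !) powers ⟩
  14 ^ i * 8 ^ L * (15 ^ n * n !)                ≡⟨ regroup (14 ^ i) (8 ^ L) (15 ^ n) (n !) ⟩
  14 ^ i * 15 ^ n * (8 ^ L * n !)                ∎)
  where
  open ≤-Reasoning
  i : ℕ
  -- The argument 2L is i/15, hence 30L steps of length 1/15, each with factor 15/14.
  i = 15 * (2 * L)
  regroup : ∀ a b c d → a * b * (c * d) ≡ a * c * (b * d)
  regroup = solve-∀
  30L : i ≡ 30 * L
  30L = sym (*-assoc 15 2 L)
  powers : 15 ^ i ≤ 14 ^ i * 8 ^ L
  powers = begin
    15 ^ i                   ≡⟨ cong (15 ^_) 30L ⟩
    15 ^ (30 * L)            ≡⟨ sym (^-*-assoc 15 30 L) ⟩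
    (15 ^ 30) ^ L            ≤⟨ ^-monoˡ-≤ L (≤ᵇ⇒≤ (15 ^ 30) (14 ^ 30 * 8) _) ⟩
    (14 ^ 30 * 8) ^ L        ≡⟨ ^-distribʳ-* L (14 ^ 30) 8 ⟩
    (14 ^ 30) ^ L * 8 ^ L    ≡⟨ cong (_* 8 ^ L) (^-*-assoc 14 30 L) ⟩
    14 ^ (30 * L) * 8 ^ L    ≡⟨ cong (λ k → 14 ^ k * 8 ^ L) (sym 30L) ⟩
    14 ^ i * 8 ^ L           ∎

-- Binomial coefficients

∑-upTo-head : ∀ n f → ∑ (upTo (suc n)) f ≡ f 0 + ∑ (upTo n) (λ k → f (suc k))
∑-upTo-head n f = cong (λ xs → f 0 + sum xs)
  (trans (map-applyUpTo suc f n) (sym (map-applyUpTo (λ k → k) (λ k → f (suc k)) n)))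

binom : ℕ → ℕ → ℕ
binom n       zero    = 1
binom zero    (suc k) = 0
binom (suc n) (suc k) = binom n k + binom n (suc k)

binom-> : ∀ {n k} → n < k → binom n k ≡ 0
binom-> {zero}  {suc k} _         = refl
binom-> {suc n} {suc k} (s≤s n<k) = cong₂ _+_ (binom-> n<k) (binom-> (m≤n⇒m≤1+n n<k))

binom-diag : ∀ n → binom n n ≡ 1
binom-diag zero    = refl
binom-diag (suc n) = cong₂ _+_ (binom-diag n) (binom-> (n<1+n n))

binom-positive : ∀ {n k} → k ≤ n → 0 < binom n k
binom-positive {n}     {zero}  _         = z<s
binom-positive {suc n} {suc k} (s≤s k≤n) = ≤-trans (binom-positive k≤n) (m≤m+n _ _)

absorption : ∀ n k → suc k * binom (suc n) (suc k) ≡ suc n * binom n k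
absorption zero    zero    = refl
absorption zero    (suc k) = *-zeroʳ (suc (suc k))
absorption (suc n) zero    = trans (cong (1 *_) (sym (+-identityʳ _))) (trans (regroup _) (cong (1 +_) (absorption n zero)))
  where
  regroup : ∀ x → 1 * (1 + x + 0) ≡ 1 + 1 * x
  regroup = solve-∀
absorption (suc n) (suc k) = begin
  suc (suc k) * (binom (suc n) (suc k) + binom (suc n) (suc (suc k)))
    ≡⟨ split (suc k) (binom (suc n) (suc k)) (binom (suc n) (suc (suc k))) ⟩
  binom (suc n) (suc k) + suc k * binom (suc n) (suc k) + suc (suc k) * binom (suc n) (suc (suc k))
    ≡⟨ cong₂ (λ x y → binom (suc n) (suc k) + x + y) (absorption n k) (absorption n (suc k)) ⟩
  binom (suc n) (suc k) + suc n * binom n k + suc n * binom n (suc k)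
    ≡⟨ merge (suc n) (binom n k) (binom n (suc k)) ⟩
  suc (suc n) * binom (suc n) (suc k) ∎
  where
  open ≡-Reasoning
  split : ∀ k x y → (1 + k) * (x + y) ≡ x + k * x + (1 + k) * y
  split = solve-∀
  merge : ∀ n x y → (x + y) + n * x + n * y ≡ (1 + n) * (x + y)
  merge = solve-∀

-- The upper limit m may exceed n, where the coefficients vanish: the induction step uses the
-- hypothesis with the limits m and m + 1.
binomial-theorem : ∀ a {n m} → n ≤ m → suc a ^ n ≡ ∑ (upTo (suc m)) (λ k → binom n k * a ^ k)
binomial-theorem a {zero} {m} _ = sym (begin
  ∑ (upTo (suc m)) (λ k → binom 0 k * a ^ k)    ≡⟨ ∑-upTo-head m (λ k → binom 0 k * a ^ k) ⟩
  1 + ∑ (upTo m) (λ _ → 0)                      ≡⟨ cong (1 +_) (trans (∑-upTo-const m 0) (*-zeroʳ m)) ⟩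
  1                                             ∎)
  where open ≡-Reasoning
binomial-theorem a {suc n} {suc m} (s≤s n≤m) = sym (begin
  ∑ (upTo (suc (suc m))) (λ k → binom (suc n) k * a ^ k)
    ≡⟨ ∑-upTo-head (suc m) (λ k → binom (suc n) k * a ^ k) ⟩
  1 + ∑ ks (λ k → (binom n k + binom n (suc k)) * (a * a ^ k))
    ≡⟨ cong (1 +_) (∑-cong ks (λ k → distribute (binom n k) (binom n (suc k)) a (a ^ k))) ⟩
  1 + ∑ ks (λ k → a * term k + term (suc k))
    ≡⟨ cong (1 +_) (∑-+ ks (λ k → a * term k) (λ k → term (suc k))) ⟩
  1 + (∑ ks (λ k → a * term k) + ∑ ks (λ k → term (suc k)))
    ≡⟨ cong (λ x → 1 + (x + ∑ ks (λ k → term (suc k)))) (∑-*ˡ ks a term) ⟩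
  1 + (a * ∑ ks term + ∑ ks (λ k → term (suc k)))
    ≡⟨ rotate (a * ∑ ks term) (∑ ks (λ k → term (suc k))) ⟩
  (1 + ∑ ks (λ k → term (suc k))) + a * ∑ ks term
    ≡⟨ cong₂ (λ x y → x + a * y) (sym (trans (binomial-theorem a (m≤n⇒m≤1+n n≤m)) (∑-upTo-head (suc m) term)))
                                 (sym (binomial-theorem a n≤m)) ⟩
  suc a ^ n + a * suc a ^ n ∎)
  where
  open ≡-Reasoning
  ks : List ℕ
  ks = upTo (suc m)
  term : ℕ → ℕ
  term k = binom n k * a ^ k
  distribute : ∀ x y a z → (x + y) * (a * z) ≡ a * (x * z) + y * (a * z)
  distribute = solve-∀
  rotate : ∀ x y → 1 + (x + y) ≡ (1 + y) + x
  rotate = solve-∀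

binom-row-sum : ∀ n → 2 ^ n ≡ ∑ (upTo (suc n)) (binom n)
binom-row-sum n = trans (binomial-theorem 1 {n} ≤-refl)
  (∑-cong (upTo (suc n)) {g = binom n} (λ k → trans (cong (binom n k *_) (^-zeroˡ k)) (*-identityʳ (binom n k))))

-- Chebyshev's lower bound

largest : ∀ {P : ℕ → Set} → (∀ v → Dec (P v)) → P 0 → ∀ b → ∃[ e ] (P e × (∀ {v} → v ≤ b → P v → v ≤ e))
largest P? p0 zero = 0 , p0 , λ v≤0 _ → v≤0
largest {P} P? p0 (suc b) with P? (suc b) | largest P? p0 b
... | yes pb | _ = suc b , pb , λ v≤ _ → v≤
... | no ¬pb | e , pe , h = e , pe , h′
  where
  h′ : ∀ {v} → v ≤ suc b → P v → v ≤ e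
  h′ v≤ pv with m≤n⇒m<n∨m≡n v≤
  ... | inj₁ (s≤s v≤b) = h v≤b pv
  ... | inj₂ refl      = contradiction pv ¬pb

n<2^n : ∀ n → n < 2 ^ n
n<2^n zero    = z<s
n<2^n (suc n) = begin-strict
  suc n             <⟨ s≤s (n<2^n n) ⟩
  1 + 2 ^ n         ≤⟨ +-monoˡ-≤ (2 ^ n) (m^n>0 2 n) ⟩
  2 ^ n + 2 ^ n     ≡⟨ cong (2 ^ n +_) (sym (+-identityʳ _)) ⟩
  2 ^ suc n         ∎
  where open ≤-Reasoning

prime⇒2≤ : ∀ {p} → Prime p → 2 ≤ p
prime⇒2≤ pp = nonTrivial⇒n>1 _ {{prime⇒nonTrivial pp}}

prime∣prime⇒≡ : ∀ {p q} → Prime p → Prime q → p ∣ q → p ≡ q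
prime∣prime⇒≡ pp pq p∣q with prime⇒irreducible pq p∣q
... | inj₁ refl = contradiction (prime⇒2≤ pp) λ { (s≤s ()) }
... | inj₂ p≡q  = p≡q

-- `b` is fuel for the recursion: dividing by p ≥ 2 lowers k.
extract-prime-power : ∀ {p} → Prime p → ∀ b k → 0 < k → k ≤ b → ∃[ v ] ∃[ r ] (k ≡ p ^ v * r × ¬ p ∣ r)
extract-prime-power {p} pp zero    k 0<k k≤b = contradiction (≤-trans 0<k k≤b) λ ()
extract-prime-power {p} pp (suc b) k 0<k k≤b with p ∣? k
... | no p∤k = 0 , k , sym (+-identityʳ k) , p∤k
... | yes (divides zero refl) = contradiction 0<k λ ()
... | yes (divides q@(suc _) refl)
    with extract-prime-power pp b q z<s (≤-pred (≤-trans (m<m*n q p (prime⇒2≤ pp)) k≤b))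
...   | v , r , q≡ , p∤r = suc v , r , trans (cong (_* p) q≡) (regroup (p ^ v) r p) , p∤r
  where
  regroup : ∀ x r p → x * r * p ≡ p * x * r
  regroup = solve-∀

primeFactor : ∀ k → 1 < k → ∃[ p ] (Prime p × p ∣ k)
primeFactor k@(suc _) 1<k with factorise k
... | record { factors = [] ; isFactorisation = eq } = contradiction 1<k (subst (λ z → ¬ 1 < z) (sym eq) λ { (s≤s ()) })
... | record { factors = p ∷ ps ; isFactorisation = eq ; factorsPrime = pp ∷ _ } =
      p , pp , subst (p ∣_) (sym eq) (m∣m*n (product ps))

π : ℕ → ℕ
π n = ∑ (upTo (suc n)) (λ k → 𝟙 (prime? k))

-- Built prime by prime: each prime up to y contributes its largest power not exceeding N, a factor
-- of at most N. The smoothness condition lets the induction on y remove one prime at a time from k.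
smooth-common-multiple : ∀ N → 0 < N → ∀ y → ∃[ D ] (0 < D × D ≤ N ^ π y ×
  (∀ k → 0 < k → k ≤ N → (∀ {p} → Prime p → p ∣ k → p ≤ y) → k ∣ D))
smooth-common-multiple N 0<N zero = 1 , z<s , ≤-refl , divides-one
  where
  divides-one : ∀ k → 0 < k → k ≤ N → (∀ {p} → Prime p → p ∣ k → p ≤ 0) → k ∣ 1
  divides-one 1 _ _ _ = ∣-refl
  divides-one k@(suc (suc _)) _ _ h with primeFactor k (s≤s z<s)
  ... | p , pp , p∣k = contradiction (≤-trans (prime⇒2≤ pp) (h pp p∣k)) λ ()
smooth-common-multiple N 0<N (suc y)
  rewrite ∑-upTo-suc (suc y) (λ k → 𝟙 (prime? k)) with smooth-common-multiple N 0<N y | prime? (suc y)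
... | D , 0<D , D≤ , h | no ¬prime rewrite +-identityʳ (π y) = D , 0<D , D≤ , λ k 0<k k≤N hk →
      h k 0<k k≤N (λ {p} pp p∣k → ≤-pred (≤∧≢⇒< (hk pp p∣k) (λ { refl → ¬prime pp })))
... | D , 0<D , D≤ , h | yes pp
    with largest (λ v → suc y ^ v ≤? N) 0<N N
...   | e , pow≤ , maximal =
        suc y ^ e * D , *-mono-≤ (m^n>0 (suc y) e) 0<D , bound , multiple
  where
  bound : suc y ^ e * D ≤ N ^ (π y + 1)
  bound = ≤-trans (*-mono-≤ pow≤ D≤) (≤-reflexive (cong (N ^_) (+-comm 1 (π y))))
  multiple : ∀ k → 0 < k → k ≤ N → (∀ {p} → Prime p → p ∣ k → p ≤ suc y) → k ∣ suc y ^ e * D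
  multiple k 0<k k≤N hk with extract-prime-power pp k k 0<k ≤-refl
  ... | v , zero , refl , p∤r = contradiction (divides 0 refl) p∤r
  ... | v , r@(suc _) , refl , p∤r = *-pres-∣ pv∣pe (h r z<s (≤-trans (m≤n*m r (suc y ^ v) {{m^n≢0 (suc y) v}}) k≤N) r-smooth)
    where
    pv≤N : suc y ^ v ≤ N
    pv≤N = ≤-trans (m≤m*n (suc y ^ v) r) k≤N
    v≤N : v ≤ N
    v≤N = ≤-trans (<⇒≤ (n<2^n v)) (≤-trans (^-monoˡ-≤ v (prime⇒2≤ pp)) pv≤N)
    v≤e : v ≤ e
    v≤e = maximal v≤N pv≤N
    pv∣pe : suc y ^ v ∣ suc y ^ e
    pv∣pe = divides (suc y ^ (e ∸ v)) (trans (cong (suc y ^_) (sym (m∸n+n≡m v≤e))) (^-distribˡ-+-* (suc y) (e ∸ v) v))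
    r-smooth : ∀ {p} → Prime p → p ∣ r → p ≤ y
    r-smooth {p} pq p∣r = ≤-pred (≤∧≢⇒< (hk pq (∣n⇒∣m*n (suc y ^ v) p∣r)) (λ { refl → p∤r p∣r }))

common-multiple : ∀ N → 0 < N → ∃[ D ] (0 < D × D ≤ N ^ π N × (∀ k → 0 < k → k ≤ N → k ∣ D))
common-multiple N 0<N with smooth-common-multiple N 0<N N
... | D , 0<D , D≤ , h = D , 0<D , D≤ , λ k 0<k k≤N →
      h k 0<k k≤N (λ {p} _ p∣k → ≤-trans (∣⇒≤ {{>-nonZero 0<k}} p∣k) k≤N)

-- Leibniz' harmonic triangle: 1/((n+2) C(n+1,k+1)) = 1/((n+1) C(n,k)) - 1/((n+2) C(n+1,k)).
leibniz : ∀ n k → let a = suc n * binom n k ; b = suc (suc n) * binom (suc n) k ; x = suc (suc n) * binom (suc n) (suc k) in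
          a * b + x * a ≡ x * b
leibniz n k = *-cancelˡ-≡ _ _ (suc k) (begin
  suc k * (a * b + x * a)       ≡⟨ step₁ (suc k) a b x ⟩
  suc k * b * a + suc k * x * a ≡⟨ cong (λ z → suc k * b * a + z * a) kx ⟩
  suc k * b * a + s * a * a     ≡⟨ step₂ (suc k * b) a s ⟩
  (suc k * b + s * a) * a       ≡⟨ cong (_* a) kb ⟩
  s * b * a                     ≡⟨ step₃ s b a ⟩
  s * a * b                     ≡⟨ cong (_* b) (sym kx) ⟩
  suc k * x * b                 ≡⟨ *-assoc (suc k) x b ⟩
  suc k * (x * b)               ∎)
  where
  open ≡-Reasoning
  s a b x : ℕ
  s = suc (suc n)
  a = suc n * binom n k
  b = s * binom (suc n) k
  x = s * binom (suc n) (suc k)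
  step₁ : ∀ k a b x → k * (a * b + x * a) ≡ k * b * a + k * x * a
  step₁ = solve-∀
  step₂ : ∀ y a s → y * a + s * a * a ≡ (y + s * a) * a
  step₂ = solve-∀
  step₃ : ∀ s b a → s * b * a ≡ s * a * b
  step₃ = solve-∀
  swap : ∀ x y z → x * (y * z) ≡ y * (x * z)
  swap = solve-∀
  kx : suc k * x ≡ s * a
  kx = trans (swap (suc k) s (binom (suc n) (suc k))) (cong (s *_) (absorption n k))
  pascal : ∀ k → k * binom (suc n) k + suc n * binom n k ≡ suc n * binom (suc n) k
  pascal zero    = refl
  pascal (suc k) = trans (cong (_+ suc n * binom n (suc k)) (absorption n k)) (sym (*-distribˡ-+ (suc n) (binom n k) _))
  kb : suc k * b + s * a ≡ s * b
  kb = trans (regroup k s (binom (suc n) k) a)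
             (trans (cong (λ z → s * (binom (suc n) k + z)) (pascal k)) refl)
    where
    regroup : ∀ k s c a → (1 + k) * (s * c) + s * a ≡ s * (c + (k * c + a))
    regroup = solve-∀

-- Induction through the harmonic triangle: the entry 1/x is a difference 1/a - 1/b of entries whose
-- denominators divide D, so D/x = D/a - D/b is an integer. The edge consists of the 1/(n+1).
leibniz-divides : ∀ {N D} → (∀ k → 0 < k → k ≤ N → k ∣ D) →
                  ∀ k n → k ≤ n → suc n ≤ N → suc n * binom n k ∣ D
leibniz-divides {N} {D} h zero    n       _         n<N = subst (_∣ D) (sym (*-identityʳ (suc n))) (h (suc n) z<s n<N)
leibniz-divides {N} {D} h (suc k) (suc n) (s≤s k≤n) n<N
  with leibniz-divides h k n k≤n (<⇒≤ n<N) | leibniz-divides h k (suc n) (m≤n⇒m≤1+n k≤n) n<N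
... | divides α D≡αa | divides β D≡βb = divides (α ∸ β) (*-cancelˡ-≡ _ _ (a * b) (begin
  a * b * D                           ≡⟨ sym (m+n∸n≡m (a * b * D) (x * a * D)) ⟩
  a * b * D + x * a * D ∸ x * a * D   ≡⟨ cong (_∸ x * a * D) (trans (sym (*-distribʳ-+ D (a * b) (x * a))) (cong (_* D) (leibniz n k))) ⟩
  x * b * D ∸ x * a * D               ≡⟨ cong₂ _∸_ (trans (cong (x * b *_) D≡αa) (re₁ x b α a)) (trans (cong (x * a *_) D≡βb) (re₁′ x a β b)) ⟩
  a * b * x * α ∸ a * b * x * β       ≡⟨ sym (*-distribˡ-∸ (a * b * x) α β) ⟩
  a * b * x * (α ∸ β)                 ≡⟨ re₂ (a * b) x (α ∸ β) ⟩
  a * b * ((α ∸ β) * x)               ∎))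
  where
  open ≡-Reasoning
  a b x : ℕ
  a = suc n * binom n k
  b = suc (suc n) * binom (suc n) k
  x = suc (suc n) * binom (suc n) (suc k)
  instance
    ab≢0 : NonZero (a * b)
    ab≢0 = >-nonZero (*-mono-≤ (*-mono-≤ (s≤s (z≤n {n})) (binom-positive k≤n))
                               (*-mono-≤ (s≤s (z≤n {suc n})) (binom-positive (m≤n⇒m≤1+n k≤n))))
  re₁ : ∀ x b α a → x * b * (α * a) ≡ a * b * x * α
  re₁ = solve-∀
  re₁′ : ∀ x a β b → x * a * (β * b) ≡ a * b * x * β
  re₁′ = solve-∀
  re₂ : ∀ y x z → y * x * z ≡ y * (z * x)
  re₂ = solve-∀

-- The n + 1 numbers (n+1)·C(n,k) sum to (n+1)·2^n and each divides D, so their mean 2^n is at most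
-- D.
chebyshev : ∀ n → 2 ^ n ≤ suc n ^ π (suc n)
chebyshev n with common-multiple (suc n) z<s
... | D , 0<D , D≤ , h = ≤-trans (*-cancelˡ-≤ (suc n) (begin
  suc n * 2 ^ n                                   ≡⟨ cong (suc n *_) (binom-row-sum n) ⟩
  suc n * ∑ (upTo (suc n)) (binom n)              ≡⟨ sym (∑-*ˡ (upTo (suc n)) (suc n) (binom n)) ⟩
  ∑ (upTo (suc n)) (λ k → suc n * binom n k)      ≤⟨ ∑-mono (upTo (suc n)) (λ {k} k∈ →
      ∣⇒≤ {{>-nonZero 0<D}} (leibniz-divides h k n (≤-pred (∈-upTo⁻ k∈)) ≤-refl)) ⟩
  ∑ (upTo (suc n)) (λ _ → D)                      ≡⟨ ∑-upTo-const (suc n) D ⟩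
  suc n * D                                       ∎)) D≤
  where open ≤-Reasoning

-- Chebyshev's bound with log₂ x replaced by any integer L above it. One exponent, that of p, then
-- serves all x = ⌊(p-1)/s⌋; the loss is of lower order.
π-lower-bound : ∀ {L} x → x ≤ 2 ^ L → x ≤ suc (L * π x)
π-lower-bound {L} zero    _  = z≤n
π-lower-bound {L} (suc n) x≤ = s≤s (^-cancel (begin
  2 ^ n                   ≤⟨ chebyshev n ⟩
  suc n ^ π (suc n)       ≤⟨ ^-monoˡ-≤ (π (suc n)) x≤ ⟩
  (2 ^ L) ^ π (suc n)     ≡⟨ ^-*-assoc 2 L (π (suc n)) ⟩
  2 ^ (L * π (suc n))     ∎))
  where
  open ≤-Reasoning
  ^-cancel : ∀ {m n} → 2 ^ m ≤ 2 ^ n → m ≤ n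
  ^-cancel {m} {n} le = ≮⇒≥ (λ n<m → <⇒≱ (^-monoʳ-< 2 (s≤s z<s) n<m) le)

-- Fermat's little theorem

∣-∑ : ∀ {d} (xs : List ℕ) f → (∀ {x} → x ∈ xs → d ∣ f x) → d ∣ ∑ xs f
∣-∑ []       f h = divides 0 refl
∣-∑ (x ∷ xs) f h = ∣m∣n⇒∣m+n (h (here refl)) (∣-∑ xs f (λ m → h (there m)))

prime∣binom : ∀ {n} → Prime (suc n) → ∀ k → k < n → suc n ∣ binom (suc n) (suc k)
prime∣binom {n} pp k k<n
  with euclidsLemma (suc k) (binom (suc n) (suc k)) pp (subst (suc n ∣_) (sym (absorption n k)) (m∣m*n (binom n k)))
... | inj₁ p∣k = contradiction (∣⇒≤ p∣k) (<⇒≱ (s≤s k<n))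
... | inj₂ p∣b = p∣b

-- Induction on a: the inner binomial coefficients of (a + 1)^p are multiples of p.
fermat : ∀ {p} → Prime p → ∀ a → ∃[ c ] a ^ p ≡ a + c * p
fermat {zero}  pp a = contradiction (prime⇒2≤ pp) λ ()
fermat {suc n} pp zero = 0 , refl
fermat {suc n} pp (suc a) with fermat pp a | ∣-∑ {suc n} (upTo n) (λ k → binom (suc n) (suc k) * a ^ suc k)
                                   (λ {k} k∈ → ∣m⇒∣m*n (a ^ suc k) (prime∣binom pp k (∈-upTo⁻ k∈)))
... | c , a^p≡ | divides d mid≡ = c + d , (begin
  suc a ^ suc n
    ≡⟨ binomial-theorem a {suc n} ≤-refl ⟩
  ∑ (upTo (suc (suc n))) term
    ≡⟨ ∑-upTo-head (suc n) term ⟩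
  1 + ∑ (upTo (suc n)) (λ k → term (suc k))
    ≡⟨ cong (1 +_) (∑-upTo-suc n (λ k → term (suc k))) ⟩
  1 + (∑ (upTo n) (λ k → term (suc k)) + binom (suc n) (suc n) * a ^ suc n)
    ≡⟨ cong₂ (λ x y → 1 + (x + y)) mid≡ (trans (cong (_* a ^ suc n) (binom-diag (suc n))) (trans (*-identityˡ _) a^p≡)) ⟩
  1 + (d * suc n + (a + c * suc n))
    ≡⟨ regroup d (suc n) a c ⟩
  suc a + (c + d) * suc n ∎)
  where
  open ≡-Reasoning
  term : ℕ → ℕ
  term k = binom (suc n) k * a ^ k
  regroup : ∀ d p a c → 1 + (d * p + (a + c * p)) ≡ (1 + a) + (c + d) * p
  regroup = solve-∀

fermat-unit : ∀ {p} → Prime p → ∀ {a} → 0 < a → a < p → ∃[ c ] a ^ (p ∸ 1) ≡ 1 + c * p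
fermat-unit {zero}  pp 0<a ()
fermat-unit {suc n} pp {a} 0<a a<p with fermat pp a
... | c , a^p≡ with euclidsLemma a (a ^ n ∸ 1) pp (divides c (begin
    a * (a ^ n ∸ 1)      ≡⟨ *-distribˡ-∸ a (a ^ n) 1 ⟩
    a ^ suc n ∸ a * 1    ≡⟨ cong₂ _∸_ a^p≡ (*-identityʳ a) ⟩
    a + c * suc n ∸ a    ≡⟨ m+n∸m≡n a (c * suc n) ⟩
    c * suc n            ∎))
  where open ≡-Reasoning
...   | inj₁ p∣a = contradiction (∣⇒≤ {{>-nonZero 0<a}} p∣a) (<⇒≱ a<p)
...   | inj₂ (divides d eq) = d , trans (sym (m+[n∸m]≡n (m^n>0 a {{>-nonZero 0<a}} n))) (cong (1 +_) eq)

-- Congruences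

infix 4 _≡_[mod_]
-- Multiples of n are added on both sides, so that congruences need neither subtraction nor
-- integers.
_≡_[mod_] : ℕ → ℕ → ℕ → Set
x ≡ y [mod n ] = ∃[ a ] ∃[ b ] x + a * n ≡ y + b * n

mod-reflexive : ∀ {n x y} → x ≡ y → x ≡ y [mod n ]
mod-reflexive refl = 0 , 0 , refl

mod-sym : ∀ {n x y} → x ≡ y [mod n ] → y ≡ x [mod n ]
mod-sym (a , b , eq) = b , a , sym eq

mod-trans : ∀ {n x y z} → x ≡ y [mod n ] → y ≡ z [mod n ] → x ≡ z [mod n ]
mod-trans {n} {x} {y} {z} (a , b , eq) (c , d , eq′) = a + c , d + b , (begin
  x + (a + c) * n       ≡⟨ shift x a c n ⟩
  (x + a * n) + c * n   ≡⟨ cong (_+ c * n) eq ⟩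
  (y + b * n) + c * n   ≡⟨ exchange y b c n ⟩
  (y + c * n) + b * n   ≡⟨ cong (_+ b * n) eq′ ⟩
  (z + d * n) + b * n   ≡⟨ sym (shift z d b n) ⟩
  z + (d + b) * n       ∎)
  where
  open ≡-Reasoning
  shift : ∀ x a c n → x + (a + c) * n ≡ (x + a * n) + c * n
  shift = solve-∀
  exchange : ∀ y b c n → (y + b * n) + c * n ≡ (y + c * n) + b * n
  exchange = solve-∀

mod-*ʳ : ∀ {n x y} z → x ≡ y [mod n ] → x * z ≡ y * z [mod n ]
mod-*ʳ {n} {x} {y} z (a , b , eq) = a * z , b * z , trans (factor x a z n) (trans (cong (_* z) eq) (sym (factor y b z n)))
  where
  factor : ∀ x a z n → x * z + a * z * n ≡ (x + a * n) * z
  factor = solve-∀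

mod-*ˡ : ∀ {n x y} z → x ≡ y [mod n ] → z * x ≡ z * y [mod n ]
mod-*ˡ {x = x} {y} z h =
  mod-trans (mod-reflexive (*-comm z x)) (mod-trans (mod-*ʳ z h) (mod-reflexive (*-comm y z)))

mod-* : ∀ {n x y z w} → x ≡ y [mod n ] → z ≡ w [mod n ] → x * z ≡ y * w [mod n ]
mod-* {y = y} {z} h h′ = mod-trans (mod-*ʳ z h) (mod-*ˡ y h′)

%≡⇒mod : ∀ {n x y} .{{_ : NonZero n}} → x % n ≡ y % n → x ≡ y [mod n ]
%≡⇒mod {n} {x} {y} eq = y / n , x / n , (begin
  x + y / n * n                         ≡⟨ cong (_+ y / n * n) (m≡m%n+[m/n]*n x n) ⟩
  x % n + x / n * n + y / n * n         ≡⟨ cong (λ r → r + x / n * n + y / n * n) eq ⟩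
  y % n + x / n * n + y / n * n         ≡⟨ exchange (y % n) _ _ ⟩
  y % n + y / n * n + x / n * n         ≡⟨ cong (_+ x / n * n) (sym (m≡m%n+[m/n]*n y n)) ⟩
  y + x / n * n                         ∎)
  where
  open ≡-Reasoning
  exchange : ∀ r a b → r + a + b ≡ r + b + a
  exchange = solve-∀

mod-<⇒≡ : ∀ {n x y} → x < n → y < n → x ≡ y [mod n ] → x ≡ y
mod-<⇒≡ {n@(suc _)} {x} {y} x<n y<n (a , b , eq) = begin
  x                  ≡⟨ sym (m<n⇒m%n≡m x<n) ⟩
  x % n              ≡⟨ sym ([m+kn]%n≡m%n x a n) ⟩
  (x + a * n) % n    ≡⟨ cong (_% n) eq ⟩
  (y + b * n) % n    ≡⟨ [m+kn]%n≡m%n y b n ⟩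
  y % n              ≡⟨ m<n⇒m%n≡m y<n ⟩
  y                  ∎
  where open ≡-Reasoning

power-expansion : ∀ x h n → ∃[ c ] (x + h) ^ suc n ≡ x ^ suc n + suc n * h * x ^ n + c * (h * h)
power-expansion x h zero    = 0 , base x h
  where
  base : ∀ x h → (x + h) * 1 ≡ x * 1 + 1 * h * 1 + 0
  base = solve-∀
power-expansion x h (suc n) with power-expansion x h n
... | c , eq = suc n * x ^ n + c * (x + h) , trans (cong ((x + h) *_) eq) (expand x h (x ^ n) (suc n) c)
  where
  expand : ∀ x h y s c → (x + h) * (x * y + s * h * y + c * (h * h)) ≡
           x * (x * y) + (1 + s) * h * (x * y) + (s * y + c * (x + h)) * (h * h)
  expand = solve-∀

-- In (x + ap)^p the linear term carries the p of the exponent and the p of the increment, and the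
-- later terms carry (ap)², so only x^p survives modulo p².
mod-^-lift : ∀ {p x y} → x ≡ y [mod p ] → x ^ p ≡ y ^ p [mod p * p ]
mod-^-lift {zero}  _ = 0 , 0 , refl
mod-^-lift {p@(suc n)} {x} {y} (a , b , eq) =
  mod-trans (mod-sym (shifted x a)) (mod-trans (mod-reflexive (cong (_^ p) eq)) (shifted y b))
  where
  shifted : ∀ x a → (x + a * p) ^ p ≡ x ^ p [mod p * p ]
  shifted x a with power-expansion x (a * p) n
  ... | c , eq′ = 0 , a * x ^ n + c * (a * a) ,
        trans (+-identityʳ _) (trans eq′ (regroup (x ^ p) p a (x ^ n) c))
    where
    regroup : ∀ z p a y c → z + p * (a * p) * y + c * (a * p * (a * p)) ≡ z + (a * y + c * (a * a)) * (p * p)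
    regroup = solve-∀

-- Fermat gives u^(p-1) = 1 + cp, and the quotient is c modulo p; hence it fixes the power modulo
-- p².
quotient≡⇒mod : ∀ {p} .{{_ : NonZero p}} → Prime p → ∀ {u v} → 0 < u → u < p → 0 < v → v < p →
  fermatQuotient p u ≡ fermatQuotient p v → u ^ (p ∸ 1) ≡ v ^ (p ∸ 1) [mod p * p ]
quotient≡⇒mod {p} pp {suc u} {suc v} 0<u u<p 0<v v<p eq with fermat-unit pp 0<u u<p | fermat-unit pp 0<v v<p
... | c , u≡ | d , v≡ with %≡⇒mod {p} {c} {d} (trans (sym (reduce c u≡)) (trans eq (reduce d v≡)))
  where
  reduce : ∀ {x} c → x ≡ 1 + c * p → (x ∸ 1) / p % p ≡ c % p
  reduce c refl = cong (_% p) (m*n/n≡m c p)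
... | a , b , eq′ = a , b , (begin
  suc u ^ (p ∸ 1) + a * (p * p)    ≡⟨ cong (_+ a * (p * p)) u≡ ⟩
  1 + c * p + a * (p * p)          ≡⟨ factor c p a ⟩
  1 + (c + a * p) * p              ≡⟨ cong (λ z → 1 + z * p) eq′ ⟩
  1 + (d + b * p) * p              ≡⟨ sym (factor d p b) ⟩
  1 + d * p + b * (p * p)          ≡⟨ cong (_+ b * (p * p)) (sym v≡) ⟩
  suc v ^ (p ∸ 1) + b * (p * p)    ∎)
  where
  open ≡-Reasoning
  factor : ∀ c p a → 1 + c * p + a * (p * p) ≡ 1 + (c + a * p) * p
  factor = solve-∀

-- By Fermat, v ^ (p - 2) is an inverse of v, so this is the residue of u/v modulo p.
ratio : (p : ℕ) → .{{NonZero p}} → ℕ → ℕ → ℕ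
ratio p u v = u * v ^ (p ∸ 2) % p

-- Multiplying both residues by v v′ produces v^(p-1) and v′^(p-1), which are 1 modulo p.
ratio≡⇒mod : ∀ {p} .{{_ : NonZero p}} → Prime p → ∀ {u v u′ v′} → 0 < v → v < p → 0 < v′ → v′ < p →
  ratio p u v ≡ ratio p u′ v′ → u * v′ ≡ u′ * v [mod p ]
ratio≡⇒mod {0} pp = contradiction (prime⇒2≤ pp) λ ()
ratio≡⇒mod {1} pp = contradiction (prime⇒2≤ pp) λ { (s≤s ()) }
ratio≡⇒mod {p@(suc (suc k))} pp {u} {v} {u′} {v′} 0<v v<p 0<v′ v′<p eq =
  mod-trans (mod-sym (unit u v′ v 0<v v<p))
    (mod-trans (mod-reflexive (sym (regroup u v′ v (v ^ k))))
      (mod-trans (mod-*ʳ {x = u * v ^ k} {u′ * v′ ^ k} (v * v′) (%≡⇒mod {x = u * v ^ k} {u′ * v′ ^ k} eq))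
        (mod-trans (mod-reflexive (regroup′ u′ v v′ (v′ ^ k))) (unit u′ v v′ 0<v′ v′<p))))
  where
  unit : ∀ x y a → 0 < a → a < p → x * y * a ^ suc k ≡ x * y [mod p ]
  unit x y a 0<a a<p with fermat-unit pp 0<a a<p
  ... | c , a^≡ = 0 , x * y * c , trans (+-identityʳ _) (trans (cong (x * y *_) a^≡) (expand (x * y) c p))
    where
    expand : ∀ z c p → z * (1 + c * p) ≡ z + z * c * p
    expand = solve-∀
  regroup : ∀ u v′ v w → u * w * (v * v′) ≡ u * v′ * (v * w)
  regroup = solve-∀
  regroup′ : ∀ u v v′ w → u * w * (v * v′) ≡ u * v * (v′ * w)
  regroup′ = solve-∀

-- A ratio whose (p-1)-st power is 1 modulo p² is determined by its residue modulo p, and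
-- numerators and denominators below p are then determined up to proportionality.
same-ratio⇒proportional : ∀ {p} .{{_ : NonZero p}} → Prime p → ∀ {u v u′ v′} →
  0 < u → u < p → 0 < v → v < p → 0 < u′ → u′ < p → 0 < v′ → v′ < p →
  fermatQuotient p u ≡ fermatQuotient p v → fermatQuotient p u′ ≡ fermatQuotient p v′ →
  ratio p u v ≡ ratio p u′ v′ → u * v′ ≡ u′ * v
same-ratio⇒proportional {0} pp = contradiction (prime⇒2≤ pp) λ ()
same-ratio⇒proportional {p@(suc n)} pp {u} {v} {u′} {v′} 0<u u<p 0<v v<p 0<u′ u′<p 0<v′ v′<p quv quv′ r =
  mod-<⇒≡ (*-mono-< u<p v′<p) (*-mono-< u′<p v<p)
    -- X^p ≡ 1 modulo p², so X^(p-1) inverts X there; this cancels X from `xX≡yX`.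
    (mod-trans (mod-sym (cancel x)) (mod-trans (mod-trans (mod-reflexive (split x)) (mod-trans (mod-*ʳ (X ^ n) xX≡yX) (mod-reflexive (sym (split y))))) (cancel y)))
  where
  x y X : ℕ
  x = u * v′
  y = u′ * v
  X = x ^ n
  x≡y : x ≡ y [mod p ]
  x≡y = ratio≡⇒mod pp {u} {v} {u′} {v′} 0<v v<p 0<v′ v′<p r
  xⁿ≡yⁿ : x ^ n ≡ y ^ n [mod p * p ]
  xⁿ≡yⁿ = mod-trans (mod-reflexive (^-distribʳ-* n u v′))
    (mod-trans (mod-* (quotient≡⇒mod pp 0<u u<p 0<v v<p quv) (mod-sym (quotient≡⇒mod pp 0<u′ u′<p 0<v′ v′<p quv′)))
      (mod-reflexive (trans (*-comm (v ^ n) (u′ ^ n)) (sym (^-distribʳ-* n u′ v)))))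
  xX≡yX : x * X ≡ y * X [mod p * p ]
  -- x·X = x^p ≡ y^p = y·y^(p-1), and the last power may be replaced by X.
  xX≡yX = mod-trans (mod-^-lift x≡y) (mod-*ˡ y (mod-sym xⁿ≡yⁿ))
  X≡1 : X ≡ 1 [mod p ]
  X≡1 with fermat-unit pp 0<u u<p | fermat-unit pp 0<v′ v′<p
  ... | c , u≡ | d , v≡ = 0 , c + d + c * d * p ,
        trans (+-identityʳ _) (trans (^-distribʳ-* n u v′) (trans (cong₂ _*_ u≡ v≡) (expand c d p)))
    where
    expand : ∀ c d p → (1 + c * p) * (1 + d * p) ≡ 1 + (c + d + c * d * p) * p
    expand = solve-∀
  cancel : ∀ z → z * X ^ p ≡ z [mod p * p ]
  cancel z = mod-trans (mod-*ˡ z (mod-^-lift X≡1)) (mod-reflexive (trans (cong (z *_) (^-zeroˡ p)) (*-identityʳ z)))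
  split : ∀ z → z * X ^ p ≡ z * X * X ^ n
  split z = sym (*-assoc z X (X ^ n))

-- Weights

-- An approximation to 18/√j from below.
weight : ℕ → ℕ
weight 0 = 18
weight 1 = 18
weight 2 = 12
weight 3 = 10
weight 4 = 9
weight 5 = 8
weight 6 = 7
weight _ = 6

weight-suc : ∀ j → weight (suc j) ≤ weight j
weight-suc 0 = ≤-refl
weight-suc 1 = ≤ᵇ⇒≤ 12 18 _
weight-suc 2 = ≤ᵇ⇒≤ 10 12 _
weight-suc 3 = ≤ᵇ⇒≤ 9 10 _
weight-suc 4 = ≤ᵇ⇒≤ 8 9 _
weight-suc 5 = ≤ᵇ⇒≤ 7 8 _
weight-suc 6 = ≤ᵇ⇒≤ 6 7 _
weight-suc (suc (suc (suc (suc (suc (suc (suc j))))))) = ≤-refl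

weight-antitone : ∀ {i j} → i ≤ j → weight j ≤ weight i
weight-antitone i≤j = go (≤⇒≤′ i≤j)
  where
  go : ∀ {i j} → i ≤′ j → weight j ≤ weight i
  go ≤′-refl            = ≤-refl
  go (≤′-step {j} i≤′j) = ≤-trans (weight-suc j) (go i≤′j)

-- The condition that the weights must meet: j pairs of weight w² each, with w ≤ 18/√j, stay within
-- 324 = 18². Equality holds at j = 1, 4, 9.
weight-square : ∀ {j} → j ≤ 9 → j * (weight j * weight j) ≤ 324
weight-square j≤9 = toWitness {a? = allUpTo? (λ j → j * (weight j * weight j) ≤? 324) 10} _ (s≤s j≤9)

weight-mass : ∀ {j} → j ≤ 9 → j * weight j ≤ 54
weight-mass j≤9 = toWitness {a? = allUpTo? (λ j → j * weight j ≤? 54) 10} _ (s≤s j≤9)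

-- gain m = (m+1) weight (m+1) - m weight m.  Nine cofactors are enough for Σ gain m / (m+1) = 1623/60 to
-- exceed (3/2) · 18.
gain : ℕ → ℕ
gain 0 = 18
gain 4 = 4
gain 5 = 2
gain 6 = 0
gain _ = 6

gain-sum : ∀ {j} → j ≤ 9 → ∑ (upTo j) gain ≡ j * weight j
gain-sum j≤9 = toWitness {a? = allUpTo? (λ j → ∑ (upTo j) gain ≟ j * weight j) 10} _ (s≤s j≤9)

-- 60 times the weight gained from cofactor m + 1, in units of p/log₂ p. The factor 60 clears all
-- denominators, as `gain 6` is 0; the nine values sum to 1623.
density : ℕ → ℕ
density m = 60 * gain m / suc m

density-exact : ∀ {m} → m < 9 → density m * suc m ≡ 60 * gain m
density-exact = toWitness {a? = allUpTo? (λ m → density m * suc m ≟ 60 * gain m) 9} _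

cofactors : ℕ → ℕ → ℕ → ℕ
cofactors p l zero = 0
cofactors p l (suc k) with suc k * l <? p
... | yes _ = suc k
... | no  _ = cofactors p l k

cofactors-≤ : ∀ p l k → cofactors p l k ≤ k
cofactors-≤ p l zero = z≤n
cofactors-≤ p l (suc k) with suc k * l <? p
... | yes _ = ≤-refl
... | no  _ = m≤n⇒m≤1+n (cofactors-≤ p l k)

cofactors-< : ∀ {p} l k → 0 < p → cofactors p l k * l < p
cofactors-< l zero 0<p = 0<p
cofactors-< {p} l (suc k) 0<p with suc k * l <? p
... | yes lt = lt
... | no  _  = cofactors-< l k 0<p

-- By maximality of `cofactors`, every m < k with (m + 1)·l < p lies below it.
∑-cofactors : ∀ p l k (f : ℕ → ℕ) → ∑ (upTo k) (λ m → 𝟙 (suc m * l <? p) * f m) ≤ ∑ (upTo (cofactors p l k)) f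
∑-cofactors p l zero f = z≤n
∑-cofactors p l (suc k) f with suc k * l <? p in eq
... | yes _ = ∑-mono (upTo (suc k)) (λ {m} _ → ≤-trans (*-monoˡ-≤ (f m) (𝟙≤1 (suc m * l <? p))) (≤-reflexive (*-identityˡ (f m))))
... | no _ = ≤-trans (≤-reflexive (trans (∑-upTo-suc k (λ m → 𝟙 (suc m * l <? p) * f m))
                 (trans (cong (λ d → ∑ (upTo k) (λ m → 𝟙 (suc m * l <? p) * f m) + 𝟙 d * f k) eq) (+-identityʳ _)))) (∑-cofactors p l k f)

∑-filter : ∀ {P : ℕ → Set} (P? : ∀ x → Dec (P x)) xs f → ∑ (filter P? xs) f ≡ ∑ xs (λ x → 𝟙 (P? x) * f x)
∑-filter P? []       f = refl
∑-filter P? (x ∷ xs) f with P? x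
... | yes _ = cong₂ _+_ (sym (*-identityˡ (f x))) (∑-filter P? xs f)
... | no  _ = ∑-filter P? xs f

∑-upTo-mono : ∀ {m n} (f : ℕ → ℕ) → m ≤ n → ∑ (upTo m) f ≤ ∑ (upTo n) f
∑-upTo-mono f m≤n = go (≤⇒≤′ m≤n)
  where
  go : ∀ {m n} → m ≤′ n → ∑ (upTo m) f ≤ ∑ (upTo n) f
  go ≤′-refl = ≤-refl
  go (≤′-step {n} m≤′n) = ≤-trans (go m≤′n) (≤-trans (m≤m+n _ (f n)) (≤-reflexive (sym (∑-upTo-suc n f))))

count-below : ∀ n b → ∑ (upTo n) (λ k → 𝟙 (k <? b)) ≤ b
count-below zero    b = z≤n
count-below (suc n) b = ≤-trans (≤-reflexive (∑-upTo-suc n (λ k → 𝟙 (k <? b)))) step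
  where
  step : ∑ (upTo n) (λ k → 𝟙 (k <? b)) + 𝟙 (n <? b) ≤ b
  step with n <? b
  ... | no _    = ≤-trans (≤-reflexive (+-identityʳ _)) (count-below n b)
  ... | yes n<b = ≤-trans (+-monoˡ-≤ 1 (≤-trans (∑-mono (upTo n) (λ {k} _ → 𝟙≤1 (k <? b)))
                    (≤-reflexive (trans (∑-upTo-const n 1) (*-identityʳ n))))) (≤-trans (≤-reflexive (+-comm n 1)) n<b)

-- 9 is the largest cofactor, so a large prime divides no cofactor; only boundedly many primes are
-- lost.
Large : ℕ → Set
Large l = Prime l × 9 < l

large? : ∀ l → Dec (Large l)
large? l = prime? l ×-dec (9 <? l)

large⇒∤ : ∀ {l m} → Large l → 0 < m → m ≤ 9 → ¬ l ∣ m
large⇒∤ (_ , 9<l) 0<m m≤9 l∣m = <⇒≱ 9<l (≤-trans (∣⇒≤ {{>-nonZero 0<m}} l∣m) m≤9)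

large-factor : ∀ {l m₁ l₁ m₂ l₂} → Large l → Large l₁ → Large l₂ → 0 < m₁ → m₁ ≤ 9 → 0 < m₂ → m₂ ≤ 9 →
               l ∣ m₁ * l₁ * (m₂ * l₂) → l ≡ l₁ ⊎ l ≡ l₂
large-factor {l} {m₁} {l₁} {m₂} {l₂} big@(pl , _) (p₁ , _) (p₂ , _) 0<m₁ m₁≤ 0<m₂ m₂≤ l∣ =
  [ (λ d → inj₁ (part m₁ 0<m₁ m₁≤ p₁ d)) , (λ d → inj₂ (part m₂ 0<m₂ m₂≤ p₂ d)) ]′ (euclidsLemma (m₁ * l₁) (m₂ * l₂) pl l∣)
  where
  part : ∀ m {k} → 0 < m → m ≤ 9 → Prime k → l ∣ m * k → l ≡ k
  part m {k} 0<m m≤9 pk d with euclidsLemma m k pl d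
  ... | inj₁ l∣m = contradiction l∣m (large⇒∤ big 0<m m≤9)
  ... | inj₂ l∣k = prime∣prime⇒≡ pl pk l∣k

-- Unique factorisation: l divides the right side but no cofactor, and l ≠ l′ leaves only l = k;
-- likewise l′ = k′. Cancelling both primes leaves the cofactors.
proportional⇒same-primes : ∀ {l m l′ m′ k n k′ n′} → Large l → Large l′ → Large k → Large k′ → ¬ l ≡ l′ →
  (0 < m × m ≤ 9) → (0 < m′ × m′ ≤ 9) → (0 < n × n ≤ 9) → (0 < n′ × n′ ≤ 9) →
  m * l * (n′ * k′) ≡ n * k * (m′ * l′) → l ≡ k × l′ ≡ k′ × m * n′ ≡ n * m′
proportional⇒same-primes {l} {m} {l′} {m′} {k} {n} {k′} {n′} Ll Ll′ Lk Lk′ l≢l′ (0<m , m≤) (0<m′ , m′≤) (0<n , n≤) (0<n′ , n′≤) eq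
  with large-factor {m₁ = n} {k} {m′} {l′} Ll Lk Ll′ 0<n n≤ 0<m′ m′≤ (subst (l ∣_) eq (∣m⇒∣m*n (n′ * k′) (n∣m*n m)))
     | large-factor {m₁ = m} {l} {n′} {k′} Ll′ Ll Lk′ 0<m m≤ 0<n′ n′≤ (subst (l′ ∣_) (sym eq) (∣n⇒∣m*n (n * k) (n∣m*n m′)))
... | inj₂ l≡l′ | _         = contradiction l≡l′ l≢l′
... | inj₁ _    | inj₁ l′≡l = contradiction (sym l′≡l) l≢l′
... | inj₁ refl | inj₂ refl = refl , refl , *-cancelʳ-≡ (m * n′) (n * m′) (l * l′)
        {{m*n≢0 l l′ {{prime⇒nonZero (proj₁ Ll)}} {{prime⇒nonZero (proj₁ Ll′)}}}}
        (trans (regroup m n′ l l′) (trans eq (sym (regroup n m′ l l′))))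
  where
  regroup : ∀ a b l l′ → a * b * (l * l′) ≡ a * l * (b * l′)
  regroup = solve-∀

-- Weighted collisions and the upper bound for their energy

module Energy {p : ℕ} (pp : Prime p) where

  private instance
    p≢0 : NonZero p
    p≢0 = prime⇒nonZero pp

  q : ℕ → ℕ
  q = fermatQuotient p

  primes : List ℕ
  primes = filter large? (upTo p)

  primes-unique : Unique primes
  primes-unique = filter⁺ large? (upTo⁺ p)

  primes⇒large : ∀ {l} → l ∈ primes → Large l
  primes⇒large l∈ = proj₂ (∈-filter⁻ large? {xs = upTo p} l∈)

  top : ℕ → ℕ
  top l = cofactors p l 9

  top≤9 : ∀ l → top l ≤ 9
  top≤9 l = cofactors-≤ p l 9

  cofactor≤9 : ∀ l {m} → m < top l → 0 < suc m × suc m ≤ 9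
  cofactor≤9 l m< = z<s , ≤-trans m< (top≤9 l)

  product<p : ∀ l {m} → m < top l → suc m * l < p
  product<p l m< = ≤-<-trans (*-monoˡ-≤ l m<) (cofactors-< l 9 (>-nonZero⁻¹ p))

  0<product : ∀ {l} m → Large l → 0 < suc m * l
  0<product {l} m (_ , 9<l) = *-mono-≤ (s≤s (z≤n {m})) (≤-trans (s≤s z≤n) 9<l)

  W : ℕ → ℕ
  W l = weight (top l)

  -- The pair (l, m) stands for the multiple (m + 1)·l, so m runs from 0 to `top l` - 1.
  indices : List (ℕ × ℕ)
  indices = concatMap (λ l → map (l ,_) (upTo (top l))) primes

  value : ℕ × ℕ → ℕ
  value (l , m) = suc m * l

  ∑-indices : ∀ f → ∑ indices f ≡ ∑ primes (λ l → ∑ (upTo (top l)) (λ m → f (l , m)))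
  ∑-indices f = trans (∑-concatMap primes _ f) (∑-cong primes (λ l → ∑-map (upTo (top l)) (l ,_) f))

  value<p : ∀ {i} → i ∈ indices → value i < p
  value<p i∈ with find (∈-concatMap⁻ (λ l → map (l ,_) (upTo (top l))) {xs = primes} i∈)
  ... | l , _ , i∈l with ∈-map⁻ (l ,_) i∈l
  ...   | m , m∈ , refl = product<p l (∈-upTo⁻ m∈)

  mass : ℕ
  mass = ∑ indices (λ i → W (proj₁ i))

  mass-by-primes : mass ≡ ∑ primes (λ l → top l * W l)
  mass-by-primes = trans (∑-indices _) (∑-cong primes (λ l → ∑-upTo-const (top l) (W l)))

  -- Pairs over one prime are excluded: their ratio says nothing about l, and the class of ratio 1,
  -- for instance, would contain every pair (i, i).
  Collision : ℕ → ℕ × ℕ → ℕ × ℕ → Set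
  Collision r i j = ¬ proj₁ i ≡ proj₁ j × q (value i) ≡ q (value j) × ratio p (value i) (value j) ≡ r

  collision? : ∀ r i j → Dec (Collision r i j)
  collision? r i j = ¬? (proj₁ i ≟ proj₁ j) ×-dec ((q (value i) ≟ q (value j)) ×-dec (ratio p (value i) (value j) ≟ r))

  collision-unique : ∀ {r l m l′ m′ k n k′ n′} → l ∈ primes → l′ ∈ primes → k ∈ primes → k′ ∈ primes →
    m < top l → m′ < top l′ → n < top k → n′ < top k′ →
    Collision r (l , m) (l′ , m′) → Collision r (k , n) (k′ , n′) → l ≡ k × l′ ≡ k′ × suc m * suc n′ ≡ suc n * suc m′
  collision-unique {r} {l} {m} {l′} {m′} {k} {n} {k′} {n′} l∈ l′∈ k∈ k′∈ m< m′< n< n′< (l≢l′ , q≡ , r≡) (_ , q′≡ , r′≡) =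
    proportional⇒same-primes (primes⇒large l∈) (primes⇒large l′∈) (primes⇒large k∈) (primes⇒large k′∈) l≢l′
      (cofactor≤9 l m<) (cofactor≤9 l′ m′<) (cofactor≤9 k n<) (cofactor≤9 k′ n′<)
      (same-ratio⇒proportional pp
        (0<product m (primes⇒large l∈)) (product<p l m<) (0<product m′ (primes⇒large l′∈)) (product<p l′ m′<)
        (0<product n (primes⇒large k∈)) (product<p k n<) (0<product n′ (primes⇒large k′∈)) (product<p k′ n′<)
        q≡ q′≡ (trans r≡ (sym r′≡)))

  term : ℕ → ℕ × ℕ → ℕ × ℕ → ℕ
  term r i j = 𝟙 (collision? r i j) * (W (proj₁ i) * W (proj₁ j))

  term⇒collision : ∀ {r} i j → 0 < term r i j → Collision r i j
  term⇒collision {r} i j pos = 𝟙-positive⁻ (collision? r i j) (0<*⇒0<ˡ _ pos)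

  term≤ : ∀ r i j → term r i j ≤ W (proj₁ i) * W (proj₁ j)
  term≤ r i j = ≤-trans (*-monoˡ-≤ (W (proj₁ i) * W (proj₁ j)) (𝟙≤1 (collision? r i j))) (≤-reflexive (*-identityˡ _))

  block : ℕ → ℕ → ℕ → ℕ
  block r l l′ = ∑ (upTo (top l)) (λ m → ∑ (upTo (top l′)) (λ m′ → term r (l , m) (l′ , m′)))

  block⇒collision : ∀ {r l l′} → 0 < block r l l′ →
    ∃[ m ] ∃[ m′ ] (m < top l × m′ < top l′ × Collision r (l , m) (l′ , m′))
  block⇒collision {r} {l} {l′} pos with ∑-positive⁻ (upTo (top l)) (λ m → ∑ (upTo (top l′)) (λ m′ → term r (l , m) (l′ , m′))) pos
  ... | m , m∈ , pos′ with ∑-positive⁻ (upTo (top l′)) (λ m′ → term r (l , m) (l′ , m′)) pos′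
  ...   | m′ , m′∈ , pos″ = m , m′ , ∈-upTo⁻ m∈ , ∈-upTo⁻ m′∈ , term⇒collision (l , m) (l′ , m′) pos″

  block-unique : ∀ {r l l′ k k′} → l ∈ primes → l′ ∈ primes → k ∈ primes → k′ ∈ primes →
    0 < block r l l′ → 0 < block r k k′ → l ≡ k × l′ ≡ k′
  block-unique l∈ l′∈ k∈ k′∈ pos pos′ with block⇒collision pos | block⇒collision pos′
  ... | m , m′ , m< , m′< , c | n , n′ , n< , n′< , c′ with collision-unique l∈ l′∈ k∈ k′∈ m< m′< n< n′< c c′
  ...   | l≡k , l′≡k′ , _ = l≡k , l′≡k′

  -- In a class the quotient of the cofactors is fixed, so each cofactor on the shorter side occurs
  -- in at most one pair. That makes min(j, j′) pairs, of weight at most w² with w the weight at the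
  -- minimum.
  block-bound : ∀ {r l l′} → l ∈ primes → l′ ∈ primes → block r l l′ ≤ 324
  block-bound {r} {l} {l′} l∈ l′∈ with ≤-total (top l) (top l′)
  ... | inj₁ j≤j′ = begin
    block r l l′                           ≤⟨ ∑-mono (upTo (top l)) row ⟩
    ∑ (upTo (top l)) (λ _ → W l * W l′)    ≡⟨ ∑-upTo-const (top l) (W l * W l′) ⟩
    top l * (W l * W l′)                   ≤⟨ *-monoʳ-≤ (top l) (*-monoʳ-≤ (W l) (weight-antitone j≤j′)) ⟩
    top l * (W l * W l)                    ≤⟨ weight-square (top≤9 l) ⟩
    324                                    ∎
    where
    open ≤-Reasoning
    row : ∀ {m} → m ∈ upTo (top l) → ∑ (upTo (top l′)) (λ m′ → term r (l , m) (l′ , m′)) ≤ W l * W l′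
    row {m} m∈ = ∑-atMostOne {f = λ m′ → term r (l , m) (l′ , m′)} (upTo⁺ (top l′)) (λ {m′} _ → term≤ r (l , m) (l′ , m′))
      λ {m′} {n′} m′∈ n′∈ pos pos′ →
        suc-injective (*-cancelˡ-≡ _ _ (suc m) (sym (proj₂ (proj₂ (collision-unique l∈ l′∈ l∈ l′∈
          (∈-upTo⁻ m∈) (∈-upTo⁻ m′∈) (∈-upTo⁻ m∈) (∈-upTo⁻ n′∈) (term⇒collision (l , m) (l′ , m′) pos) (term⇒collision (l , m) (l′ , n′) pos′))))))
  ... | inj₂ j′≤j = begin
    block r l l′                           ≡⟨ ∑-swap (upTo (top l)) (upTo (top l′)) _ ⟩
    ∑ (upTo (top l′)) (λ m′ → ∑ (upTo (top l)) (λ m → term r (l , m) (l′ , m′)))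
                                           ≤⟨ ∑-mono (upTo (top l′)) column ⟩
    ∑ (upTo (top l′)) (λ _ → W l * W l′)   ≡⟨ ∑-upTo-const (top l′) (W l * W l′) ⟩
    top l′ * (W l * W l′)                  ≤⟨ *-monoʳ-≤ (top l′) (*-monoˡ-≤ (W l′) (weight-antitone j′≤j)) ⟩
    top l′ * (W l′ * W l′)                 ≤⟨ weight-square (top≤9 l′) ⟩
    324                                    ∎
    where
    open ≤-Reasoning
    column : ∀ {m′} → m′ ∈ upTo (top l′) → ∑ (upTo (top l)) (λ m → term r (l , m) (l′ , m′)) ≤ W l * W l′
    column {m′} m′∈ = ∑-atMostOne {f = λ m → term r (l , m) (l′ , m′)} (upTo⁺ (top l)) (λ {m} _ → term≤ r (l , m) (l′ , m′))
      λ {m} {n} m∈ n∈ pos pos′ →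
        suc-injective (*-cancelʳ-≡ _ _ (suc m′) (proj₂ (proj₂ (collision-unique l∈ l′∈ l∈ l′∈
          (∈-upTo⁻ m∈) (∈-upTo⁻ m′∈) (∈-upTo⁻ n∈) (∈-upTo⁻ m′∈) (term⇒collision (l , m) (l′ , m′) pos) (term⇒collision (l , n) (l′ , m′) pos′)))))

  -- All nonzero blocks of the class r coincide, by `block-unique`, so the bound for one block
  -- serves the whole class.
  class-energy : ∀ r → ∑ indices (λ i → ∑ indices (term r i)) ≤ 324
  class-energy r = begin
    ∑ indices (λ i → ∑ indices (term r i))
      ≡⟨ ∑-indices _ ⟩
    ∑ primes (λ l → ∑ (upTo (top l)) (λ m → ∑ indices (term r (l , m))))
      ≡⟨ ∑-cong primes (λ l → ∑-cong (upTo (top l)) (λ m → ∑-indices (term r (l , m)))) ⟩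
    ∑ primes (λ l → ∑ (upTo (top l)) (λ m → ∑ primes (λ l′ → ∑ (upTo (top l′)) (λ m′ → term r (l , m) (l′ , m′)))))
      ≡⟨ ∑-cong primes (λ l → ∑-swap (upTo (top l)) primes _) ⟩
    ∑ primes (λ l → ∑ primes (block r l))
      ≤⟨ ∑-atMostOne primes-unique
           (λ l∈ → ∑-atMostOne primes-unique (block-bound l∈) (λ l′∈ k′∈ pos pos′ → proj₂ (block-unique l∈ l′∈ l∈ k′∈ pos pos′)))
           same-row ⟩
    324 ∎
    where
    open ≤-Reasoning
    same-row : ∀ {l k} → l ∈ primes → k ∈ primes → 0 < ∑ primes (block r l) → 0 < ∑ primes (block r k) → l ≡ k
    same-row {l} {k} l∈ k∈ pos pos′ with ∑-positive⁻ primes (block r l) pos | ∑-positive⁻ primes (block r k) pos′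
    ... | l′ , l′∈ , b | k′ , k′∈ , b′ = proj₁ (block-unique l∈ l′∈ k∈ k′∈ b b′)

  -- The multiples of one prime weigh at most 54 together. The result is linear in `mass`, hence of
  -- lower order than 2·t·`mass` when t = 12L.
  same-prime-energy : ∑ indices (λ i → ∑ indices (λ j → 𝟙 (proj₁ i ≟ proj₁ j) * (W (proj₁ i) * W (proj₁ j)))) ≤ 54 * mass
  same-prime-energy = begin
    ∑ indices (λ i → ∑ indices (λ j → 𝟙 (proj₁ i ≟ proj₁ j) * (W (proj₁ i) * W (proj₁ j))))
      ≡⟨ ∑-cong indices (λ i → trans (∑-cong indices (λ j → swap (𝟙 (proj₁ i ≟ proj₁ j)) (W (proj₁ i)) (W (proj₁ j))))
                                     (∑-*ˡ indices (W (proj₁ i)) _)) ⟩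
    ∑ indices (λ i → W (proj₁ i) * ∑ indices (λ j → 𝟙 (proj₁ i ≟ proj₁ j) * W (proj₁ j)))
      ≤⟨ ∑-mono indices (λ {i} _ → *-monoʳ-≤ (W (proj₁ i)) (same (proj₁ i))) ⟩
    ∑ indices (λ i → W (proj₁ i) * 54)
      ≡⟨ ∑-*ʳ indices 54 _ ⟩
    mass * 54
      ≡⟨ *-comm mass 54 ⟩
    54 * mass ∎
    where
    open ≤-Reasoning
    swap : ∀ x y z → x * (y * z) ≡ y * (x * z)
    swap = solve-∀
    same : ∀ l → ∑ indices (λ j → 𝟙 (l ≟ proj₁ j) * W (proj₁ j)) ≤ 54
    same l = begin
      ∑ indices (λ j → 𝟙 (l ≟ proj₁ j) * W (proj₁ j))
        ≡⟨ ∑-indices _ ⟩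
      ∑ primes (λ k → ∑ (upTo (top k)) (λ _ → 𝟙 (l ≟ k) * W k))
        ≡⟨ ∑-cong primes (λ k → trans (∑-upTo-const (top k) _) (swap (top k) (𝟙 (l ≟ k)) (W k))) ⟩
      ∑ primes (λ k → 𝟙 (l ≟ k) * (top k * W k))
        ≤⟨ ∑-atMostOne primes-unique
             (λ {k} _ → ≤-trans (*-monoˡ-≤ (top k * W k) (𝟙≤1 (l ≟ k))) (≤-trans (≤-reflexive (*-identityˡ _)) (weight-mass (top≤9 k))))
             (λ {k} {k′} _ _ pos pos′ → trans (sym (𝟙-positive⁻ (l ≟ k) (0<*⇒0<ˡ _ pos))) (𝟙-positive⁻ (l ≟ k′) (0<*⇒0<ˡ _ pos′))) ⟩
      54 ∎

  -- Equal quotients over different primes form a collision in the class of their own ratio.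
  split-pair : ∀ i j → 𝟙 (q (value i) ≟ q (value j)) * (W (proj₁ i) * W (proj₁ j)) ≤
    𝟙 (proj₁ i ≟ proj₁ j) * (W (proj₁ i) * W (proj₁ j)) + ∑ (upTo p) (λ r → term r i j)
  split-pair i j = cases (q (value i) ≟ q (value j)) (proj₁ i ≟ proj₁ j)
    where
    open ≤-Reasoning
    w r₀ : ℕ
    w  = W (proj₁ i) * W (proj₁ j)
    r₀ = ratio p (value i) (value j)
    cases : (c : Dec (q (value i) ≡ q (value j))) (d : Dec (proj₁ i ≡ proj₁ j)) →
            𝟙 c * w ≤ 𝟙 d * w + ∑ (upTo p) (λ r → term r i j)
    cases (no _)   _       = z≤n
    cases (yes _)  (yes _) = m≤m+n (1 * w) _
    cases (yes q≡) (no l≢) = begin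
      1 * w                              ≡⟨ cong (_* w) (sym (𝟙-true (collision? r₀ i j) (l≢ , q≡ , refl))) ⟩
      term r₀ i j                        ≤⟨ term≤∑ (upTo p) (λ r → term r i j) (∈-upTo⁺ (m%n<n _ p)) ⟩
      ∑ (upTo p) (λ r → term r i j)      ∎

  energy-bound : ∑ indices (λ i → ∑ indices (λ j → 𝟙 (q (value i) ≟ q (value j)) * (W (proj₁ i) * W (proj₁ j)))) ≤
                 54 * mass + p * 324
  energy-bound = begin
    ∑ indices (λ i → ∑ indices (λ j → 𝟙 (q (value i) ≟ q (value j)) * (W (proj₁ i) * W (proj₁ j))))
      ≤⟨ ∑-mono indices (λ {i} _ → ∑-mono indices (λ {j} _ → split-pair i j)) ⟩
    ∑ indices (λ i → ∑ indices (λ j → same i j + ∑ (upTo p) (λ r → term r i j)))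
      ≡⟨ ∑-cong indices (λ i → ∑-+ indices (same i) (λ j → ∑ (upTo p) (λ r → term r i j))) ⟩
    ∑ indices (λ i → ∑ indices (same i) + ∑ indices (λ j → ∑ (upTo p) (λ r → term r i j)))
      ≡⟨ ∑-+ indices (λ i → ∑ indices (same i)) (λ i → ∑ indices (λ j → ∑ (upTo p) (λ r → term r i j))) ⟩
    ∑ indices (λ i → ∑ indices (same i)) + ∑ indices (λ i → ∑ indices (λ j → ∑ (upTo p) (λ r → term r i j)))
      ≤⟨ +-mono-≤ same-prime-energy classes ⟩
    54 * mass + p * 324 ∎
    where
    open ≤-Reasoning
    same : ℕ × ℕ → ℕ × ℕ → ℕ
    same i j = 𝟙 (proj₁ i ≟ proj₁ j) * (W (proj₁ i) * W (proj₁ j))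
    classes : ∑ indices (λ i → ∑ indices (λ j → ∑ (upTo p) (λ r → term r i j))) ≤ p * 324
    classes = begin
      ∑ indices (λ i → ∑ indices (λ j → ∑ (upTo p) (λ r → term r i j)))
        ≡⟨ ∑-cong indices (λ i → ∑-swap indices (upTo p) (λ j r → term r i j)) ⟩
      ∑ indices (λ i → ∑ (upTo p) (λ r → ∑ indices (λ j → term r i j)))
        ≡⟨ ∑-swap indices (upTo p) (λ i r → ∑ indices (λ j → term r i j)) ⟩
      ∑ (upTo p) (λ r → ∑ indices (λ i → ∑ indices (λ j → term r i j)))
        ≤⟨ ∑-mono (upTo p) (λ {r} _ → class-energy r) ⟩
      ∑ (upTo p) (λ _ → 324)
        ≡⟨ ∑-upTo-const p 324 ⟩
      p * 324 ∎

  image-bound : ∀ t → 2 * (t * mass) ≤ M p * (t * t) + (54 * mass + p * 324)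
  image-bound t = ≤-trans
    (fibre-energy indices (λ i → W (proj₁ i)) (λ i → q (value i)) (deduplicate _≟_ (map q (upTo p))) (deduplicate-! _)
      (λ i∈ → ∈-deduplicate⁺ _≟_ (∈-map⁺ q (∈-upTo⁺ (value<p i∈)))) t)
    (+-monoʳ-≤ (M p * (t * t)) energy-bound)

  -- Lower bound for the total weight

  multiples : ℕ → ℕ
  multiples m = ∑ primes (λ l → 𝟙 (suc m * l <? p))

  π≤multiples : ∀ m x → suc m * x < p → π x ≤ multiples m + 10
  π≤multiples m x mx<p = begin
    π x
      ≤⟨ ∑-mono (upTo (suc x)) (λ {k} k∈ → pointwise k (≤-pred (∈-upTo⁻ k∈))) ⟩
    ∑ (upTo (suc x)) (λ k → hit k + 𝟙 (k <? 10))
      ≡⟨ ∑-+ (upTo (suc x)) hit (λ k → 𝟙 (k <? 10)) ⟩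
    ∑ (upTo (suc x)) hit + ∑ (upTo (suc x)) (λ k → 𝟙 (k <? 10))
      ≤⟨ +-mono-≤ (∑-upTo-mono hit (≤-<-trans (m≤m+n x (m * x)) mx<p)) (count-below (suc x) 10) ⟩
    ∑ (upTo p) hit + 10
      ≡⟨ cong (_+ 10) (sym (∑-filter large? (upTo p) (λ l → 𝟙 (suc m * l <? p)))) ⟩
    multiples m + 10 ∎
    where
    open ≤-Reasoning
    hit : ℕ → ℕ
    hit k = 𝟙 (large? k) * 𝟙 (suc m * k <? p)
    pointwise : ∀ k → k ≤ x → 𝟙 (prime? k) ≤ hit k + 𝟙 (k <? 10)
    pointwise k k≤x = go (prime? k) (k <? 10)
      where
      go : (d : Dec (Prime k)) (e : Dec (k < 10)) → 𝟙 d ≤ hit k + 𝟙 e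
      go (no _)   _          = z≤n
      go (yes _)  (yes _)    = m≤n+m 1 (hit k)
      go (yes pk) (no k≮10) = ≤-trans (≤-reflexive (sym (cong₂ _*_ (𝟙-true (large? k) (pk , ≮⇒≥ k≮10))
                                 (𝟙-true (suc m * k <? p) (≤-<-trans (*-monoʳ-≤ (suc m) k≤x) mx<p))))) (m≤m+n _ 0)

  multiples-bound : ∀ {K} → p ≤ 2 ^ K → 0 < K → ∀ {m} → m < 9 → p ≤ suc m * (K * multiples m) + 108 * K
  multiples-bound {K} p≤2^K 0<K {m} m<9 = begin
    p                                          ≡⟨ sym (suc-pred p) ⟩
    suc n                                      ≤⟨ n<s[x+1] ⟩
    s * suc x                                  ≤⟨ *-monoʳ-≤ s (s≤s (π-lower-bound {K} x (≤-trans x≤p p≤2^K))) ⟩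
    s * suc (suc (K * π x))                    ≤⟨ *-monoʳ-≤ s (s≤s (s≤s (*-monoʳ-≤ K (π≤multiples m x sx<p)))) ⟩
    s * suc (suc (K * (multiples m + 10)))     ≡⟨ expand s K (multiples m) ⟩
    s * (K * multiples m) + (s * (10 * K) + 2 * s)
      -- With s ≤ 9 and K ≥ 1, the dropped small primes cost 90K and the roundings 18K, together
      -- 108K.
      ≤⟨ +-monoʳ-≤ (s * (K * multiples m)) (+-mono-≤ (*-monoˡ-≤ (10 * K) m<9) (≤-trans (*-monoʳ-≤ 2 m<9) (*-monoʳ-≤ 18 0<K))) ⟩
    s * (K * multiples m) + (9 * (10 * K) + 18 * K)
      ≡⟨ cong (s * (K * multiples m) +_) (collect K) ⟩
    s * (K * multiples m) + 108 * K ∎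
    where
    open ≤-Reasoning
    n s x : ℕ
    n = pred p
    s = suc m
    x = n / s
    expand : ∀ s K c → s * (1 + (1 + K * (c + 10))) ≡ s * (K * c) + (s * (10 * K) + 2 * s)
    expand = solve-∀
    collect : ∀ K → 9 * (10 * K) + 18 * K ≡ 108 * K
    collect = solve-∀
    n<s[x+1] : n < s * suc x
    n<s[x+1] = begin-strict
      n                 ≡⟨ m≡m%n+[m/n]*n n s ⟩
      n % s + x * s     <⟨ +-monoˡ-< (x * s) (m%n<n n s) ⟩
      s + x * s         ≡⟨ *-comm (suc x) s ⟩
      s * suc x         ∎
    sx<p : s * x < p
    sx<p = begin-strict
      s * x     ≡⟨ *-comm s x ⟩
      x * s     ≤⟨ m/n*n≤m n s ⟩
      n         <⟨ n<1+n n ⟩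
      suc n     ≡⟨ suc-pred p ⟩
      p         ∎
    x≤p : x ≤ p
    x≤p = ≤-trans (m≤m+n x (m * x)) (<⇒≤ sx<p)

  -- Summation by parts: the multiples of l weigh j·w, the sum of `gain m` over m < j. Exchanging
  -- sums counts, for each m, the primes with (m + 1)·l < p.
  mass≥gains : ∑ (upTo 9) (λ m → gain m * multiples m) ≤ mass
  mass≥gains = begin
    ∑ (upTo 9) (λ m → gain m * multiples m)
      ≡⟨ ∑-cong (upTo 9) (λ m → sym (∑-*ˡ primes (gain m) (λ l → 𝟙 (suc m * l <? p)))) ⟩
    ∑ (upTo 9) (λ m → ∑ primes (λ l → gain m * 𝟙 (suc m * l <? p)))
      ≡⟨ ∑-swap (upTo 9) primes (λ m l → gain m * 𝟙 (suc m * l <? p)) ⟩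
    ∑ primes (λ l → ∑ (upTo 9) (λ m → gain m * 𝟙 (suc m * l <? p)))
      ≤⟨ ∑-mono primes (λ {l} _ → per-prime l) ⟩
    ∑ primes (λ l → top l * W l)
      ≡⟨ sym mass-by-primes ⟩
    mass ∎
    where
    open ≤-Reasoning
    per-prime : ∀ l → ∑ (upTo 9) (λ m → gain m * 𝟙 (suc m * l <? p)) ≤ top l * W l
    per-prime l = begin
      ∑ (upTo 9) (λ m → gain m * 𝟙 (suc m * l <? p))   ≡⟨ ∑-cong (upTo 9) (λ m → *-comm (gain m) (𝟙 (suc m * l <? p))) ⟩
      ∑ (upTo 9) (λ m → 𝟙 (suc m * l <? p) * gain m)   ≤⟨ ∑-cofactors p l 9 gain ⟩
      ∑ (upTo (top l)) gain                            ≡⟨ gain-sum (top≤9 l) ⟩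
      top l * W l                                      ∎

  mass-bound : ∀ {K} → p ≤ 2 ^ K → 0 < K → 1623 * p ≤ 60 * (K * mass) + 1623 * (108 * K)
  mass-bound {K} p≤2^K 0<K = begin
    1623 * p
      ≡⟨ sym (∑-*ʳ (upTo 9) p density) ⟩
    ∑ (upTo 9) (λ m → density m * p)
      ≤⟨ ∑-mono (upTo 9) (λ m∈ → each (∈-upTo⁻ m∈)) ⟩
    ∑ (upTo 9) (λ m → 60 * K * (gain m * multiples m) + density m * (108 * K))
      ≡⟨ ∑-+ (upTo 9) (λ m → 60 * K * (gain m * multiples m)) (λ m → density m * (108 * K)) ⟩
    ∑ (upTo 9) (λ m → 60 * K * (gain m * multiples m)) + ∑ (upTo 9) (λ m → density m * (108 * K))
      ≡⟨ cong₂ _+_ (∑-*ˡ (upTo 9) (60 * K) (λ m → gain m * multiples m)) (∑-*ʳ (upTo 9) (108 * K) density) ⟩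
    60 * K * ∑ (upTo 9) (λ m → gain m * multiples m) + 1623 * (108 * K)
      ≤⟨ +-monoˡ-≤ (1623 * (108 * K)) (*-monoʳ-≤ (60 * K) mass≥gains) ⟩
    60 * K * mass + 1623 * (108 * K)
      ≡⟨ cong (_+ 1623 * (108 * K)) (*-assoc 60 K mass) ⟩
    60 * (K * mass) + 1623 * (108 * K) ∎
    where
    open ≤-Reasoning
    each : ∀ {m} → m < 9 → density m * p ≤ 60 * K * (gain m * multiples m) + density m * (108 * K)
    each {m} m<9 = begin
      density m * p
        ≤⟨ *-monoʳ-≤ (density m) (multiples-bound p≤2^K 0<K m<9) ⟩
      density m * (suc m * (K * multiples m) + 108 * K)
        ≡⟨ regroup (density m) (suc m) (K * multiples m) (108 * K) ⟩
      density m * suc m * (K * multiples m) + density m * (108 * K)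
        ≡⟨ cong (λ z → z * (K * multiples m) + density m * (108 * K)) (density-exact m<9) ⟩
      60 * gain m * (K * multiples m) + density m * (108 * K)
        ≡⟨ cong (_+ density m * (108 * K)) (regroup′ 60 (gain m) K (multiples m)) ⟩
      60 * K * (gain m * multiples m) + density m * (108 * K) ∎
      where
      regroup : ∀ d s y z → d * (s * y + z) ≡ d * s * y + d * z
      regroup = solve-∀
      regroup′ : ∀ a g K c → a * g * (K * c) ≡ a * K * (g * c)
      regroup′ = solve-∀

-- Comparison of the two bounds

-- Turns the error of size L(L + 1) in the comparison into a multiple of p.
n[n+1]≤2^n : ∀ {n} → 5 ≤ n → n * suc n ≤ 2 ^ n
n[n+1]≤2^n 5≤n = go (≤⇒≤′ 5≤n)
  where
  open ≤-Reasoning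
  double : ∀ n → (1 + n) * (2 + n) + n * n + n ≡ 2 * (n * (1 + n)) + (2 + 2 * n)
  double = solve-∀
  go : ∀ {n} → 5 ≤′ n → n * suc n ≤ 2 ^ n
  go ≤′-refl = ≤ᵇ⇒≤ 30 32 _
  go (≤′-step {n} 5≤′n) = ≤-trans (+-cancelʳ-≤ (n * n + n) _ _ (begin
    suc n * suc (suc n) + (n * n + n)     ≡⟨ sym (+-assoc (suc n * suc (suc n)) (n * n) n) ⟩
    suc n * suc (suc n) + n * n + n       ≡⟨ double n ⟩
    2 * (n * suc n) + (2 + 2 * n)         ≤⟨ +-monoʳ-≤ (2 * (n * suc n)) (begin
      2 + 2 * n       ≤⟨ +-monoˡ-≤ (2 * n) (≤-trans (≤ᵇ⇒≤ 2 5 _) 5≤n′) ⟩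
      n + 2 * n       ≤⟨ *-monoˡ-≤ n (≤-trans (≤ᵇ⇒≤ 3 5 _) 5≤n′) ⟩
      n * n           ≤⟨ m≤m+n (n * n) n ⟩
      n * n + n       ∎) ⟩
    2 * (n * suc n) + (n * n + n)         ∎)) (*-monoʳ-≤ 2 (go 5≤′n))
    where
    5≤n′ : 5 ≤ n
    5≤n′ = ≤′⇒≤ 5≤′n

binary-length : ∀ p → 0 < p → ∃[ L ] (2 ^ L ≤ p × p < 2 ^ suc L × (∀ {B} → 2 ^ B ≤ p → B ≤ L))
binary-length p 0<p with largest (λ v → 2 ^ v ≤? p) 0<p p
... | L , pow≤ , maximal = L , pow≤ , ≰⇒> (λ le → contradiction (below le) 1+n≰n) , below
  where
  below : ∀ {B} → 2 ^ B ≤ p → B ≤ L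
  below {B} le = maximal (≤-trans (<⇒≤ (n<2^n B)) le) le

-- If 4L²m < 9p, the two bounds on N leave 2tg·Lp ≤ 2hR·Lp + O(p), and x is the gap of the leading coefficients.
combine-bounds : ∀ {t s d R h g k x B L N p m} → t * t ≡ 4 * s → R ≡ 9 * s →
  2 * t * g ≡ h * (2 * R) + x → h * (2 * R) + d * g + g * k * (2 * t) < x * B →
  B ≤ L → d ≤ 2 * t * L → 0 < p → L * suc L ≤ p →
  2 * (t * L * N) ≤ m * (t * L * (t * L)) + (d * N + p * R) →
  g * p ≤ h * (suc L * N) + g * (k * suc L) →
  9 * p ≤ 4 * (L * L) * m
combine-bounds {t} {s} {d} {R} {h} {g} {k} {x} {B} {L} {N} {p} {m} t²≡ R≡ gap large B≤L d≤ 0<p LK≤p upper lower = ≮⇒≥ absurd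
  where
  open ≤-Reasoning
  K D : ℕ
  K = suc L
  D = 2 * t * L ∸ d

  D+d : D + d ≡ 2 * t * L
  D+d = m∸n+n≡m d≤

  absurd : 4 * (L * L) * m < 9 * p → ⊥
  absurd small = <⇒≱ large (begin
    x * B                                        ≤⟨ *-monoʳ-≤ x B≤L ⟩
    x * L                                        ≤⟨ *-cancelʳ-≤ (x * L) _ p {{>-nonZero 0<p}} leading ⟩
    h * (2 * R) + d * g + g * k * (2 * t)        ∎)
    where
    -- t and R are matched so that m·(tL)² reaches the class energy R·p exactly at 4L²m = 9p; below
    -- that, the two terms together stay within 2R·p.
    DN≤ : D * N ≤ 2 * R * p
    DN≤ = +-cancelʳ-≤ (d * N) _ _ (begin
      D * N + d * N                             ≡⟨ sym (*-distribʳ-+ N D d) ⟩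
      (D + d) * N                               ≡⟨ cong (_* N) D+d ⟩
      2 * t * L * N                             ≡⟨ double t L N ⟩
      2 * (t * L * N)                           ≤⟨ upper ⟩
      m * (t * L * (t * L)) + (d * N + p * R)   ≡⟨ square m t L (d * N) (p * R) ⟩
      t * t * (L * L * m) + p * R + d * N       ≡⟨ cong₂ (λ y z → y * (L * L * m) + p * z + d * N) t²≡ R≡ ⟩
      4 * s * (L * L * m) + p * (9 * s) + d * N ≡⟨ regroup s L m p (d * N) ⟩
      s * (4 * (L * L) * m) + s * (9 * p) + d * N
        ≤⟨ +-monoˡ-≤ (d * N) (+-monoˡ-≤ (s * (9 * p)) (*-monoʳ-≤ s (<⇒≤ small))) ⟩
      s * (9 * p) + s * (9 * p) + d * N         ≡⟨ cong (_+ d * N) (total s p) ⟩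
      2 * (9 * s) * p + d * N                   ≡⟨ cong (λ z → 2 * z * p + d * N) (sym R≡) ⟩
      2 * R * p + d * N                         ∎)
      where
      double : ∀ t L N → 2 * t * L * N ≡ 2 * (t * L * N)
      double = solve-∀
      square : ∀ m t L y z → m * (t * L * (t * L)) + (y + z) ≡ t * t * (L * L * m) + z + y
      square = solve-∀
      regroup : ∀ s L m p y → 4 * s * (L * L * m) + p * (9 * s) + y ≡ s * (4 * (L * L) * m) + s * (9 * p) + y
      regroup = solve-∀
      total : ∀ s p → s * (9 * p) + s * (9 * p) ≡ 2 * (9 * s) * p
      total = solve-∀

    -- The lower bound for N times D; L·K ≤ p absorbs its error term.
    Dp≤ : D * (g * p) ≤ h * (2 * R) * (K * p) + g * k * (2 * t) * p
    Dp≤ = begin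
      D * (g * p)                                   ≤⟨ *-monoʳ-≤ D lower ⟩
      D * (h * (K * N) + g * (k * K))               ≡⟨ regroup h g k D K N ⟩
      h * (K * (D * N)) + g * k * (D * K)
        ≤⟨ +-mono-≤ (*-monoʳ-≤ h (*-monoʳ-≤ K DN≤))
                    (*-monoʳ-≤ (g * k) (*-monoˡ-≤ K (≤-trans (m≤m+n D d) (≤-reflexive D+d)))) ⟩
      h * (K * (2 * R * p)) + g * k * (2 * t * L * K) ≡⟨ regroup′ h (2 * R) (g * k) (2 * t) K p L ⟩
      h * (2 * R) * (K * p) + g * k * (2 * t) * (L * K)
        ≤⟨ +-monoʳ-≤ (h * (2 * R) * (K * p)) (*-monoʳ-≤ (g * k * (2 * t)) LK≤p) ⟩
      h * (2 * R) * (K * p) + g * k * (2 * t) * p   ∎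
      where
      regroup : ∀ a b c D K N → D * (a * (K * N) + b * (c * K)) ≡ a * (K * (D * N)) + b * c * (D * K)
      regroup = solve-∀
      regroup′ : ∀ a b c e K p L → a * (K * (b * p)) + c * (e * L * K) ≡ a * b * (K * p) + c * e * (L * K)
      regroup′ = solve-∀

    leading : x * L * p ≤ (h * (2 * R) + d * g + g * k * (2 * t)) * p
    leading = +-cancelˡ-≤ (a * (L * p)) _ _ (begin
      a * (L * p) + x * L * p                      ≡⟨ collect a x L p ⟩
      (a + x) * (L * p)                            ≡⟨ cong (_* (L * p)) (sym gap) ⟩
      2 * t * g * (L * p)                          ≡⟨ factor (2 * t) g L p ⟩
      2 * t * L * (g * p)                          ≡⟨ cong (_* (g * p)) (sym D+d) ⟩
      (D + d) * (g * p)                            ≡⟨ *-distribʳ-+ (g * p) D d ⟩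
      D * (g * p) + d * (g * p)                    ≤⟨ +-monoˡ-≤ (d * (g * p)) Dp≤ ⟩
      a * (K * p) + b * p + d * (g * p)            ≡⟨ rearrange a b d g L p ⟩
      a * (L * p) + (a + d * g + b) * p            ∎)
      where
      a b : ℕ
      a = h * (2 * R)
      b = g * k * (2 * t)
      collect : ∀ a x L p → a * (L * p) + x * L * p ≡ (a + x) * (L * p)
      collect = solve-∀
      factor : ∀ e g L p → e * g * (L * p) ≡ e * L * (g * p)
      factor = solve-∀
      rearrange : ∀ a b d g L p → a * ((1 + L) * p) + b * p + d * (g * p) ≡ a * (L * p) + (a + d * g + b) * p
      rearrange = solve-∀

-- t = 12L makes M·t² = 324p at the critical size M = 9p/(4L²), which calls for total weight 27p/L.
-- The gap is x = 24·1623 - 60·648 = 72, and B = 60187 makes 72B = 4333464 exceed the error 4333338.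
image-lower-bound : ∀ {p L} (pp : Prime p) → 60187 ≤ L → 2 ^ L ≤ p → p < 2 ^ suc L →
                    9 * p ≤ 4 * (L * L) * M p {{prime⇒nonZero pp}}
image-lower-bound {p} {L} pp big 2^L≤p p<2^K =
  combine-bounds {t = 12} {s = 36} {d = 54} {R = 324} {h = 60} {g = 1623} {k = 108} {x = 72} {B = 60187} {N = mass}
    refl refl refl (≤ᵇ⇒≤ 4333339 4333464 _) big
    (≤-trans (≤ᵇ⇒≤ 54 1444488 _) (*-monoʳ-≤ 24 big))
    (≤-trans (m^n>0 2 L) 2^L≤p) (≤-trans (n[n+1]≤2^n (≤-trans (≤ᵇ⇒≤ 5 60187 _) big)) 2^L≤p)
    (image-bound (12 * L)) (mass-bound (<⇒≤ p<2^K) z<s)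
  where open Energy pp using (mass; image-bound; mass-bound)

theorem10 : (m : ℕ) → ∃[ P ] ((p : ℕ) → P ≤ p → (pr : Prime p) →
    ∃[ a ] ∃[ b ] (0 < b × LogLowerBound a b p
    × m * p * b ^ 2 ≤ suc m * a ^ 2 * M p {{prime⇒nonZero pr}}))
-- `image-lower-bound` has no loss factor, so one threshold serves every m.
theorem10 m = 2 ^ 60187 , λ p P≤p pr → bound p P≤p pr (binary-length p (≤-trans (m^n>0 2 60187) P≤p))
  where
  open ≤-Reasoning
  bound : ∀ p → 2 ^ 60187 ≤ p → (pr : Prime p) →
    ∃[ L ] (2 ^ L ≤ p × p < 2 ^ suc L × (∀ {B} → 2 ^ B ≤ p → B ≤ L)) →
    ∃[ a ] ∃[ b ] (0 < b × LogLowerBound a b p × m * p * b ^ 2 ≤ suc m * a ^ 2 * M p {{prime⇒nonZero pr}})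
  -- By e² ≤ 8 = 2³ and 2^L ≤ p, the fraction 2L/3 is at most log p.
  bound p P≤p pr (L , 2^L≤p , p<2^K , below) = 2 * L , 3 , z<s , log , (begin
    m * p * 3 ^ 2                     ≡⟨ left m p ⟩
    m * (9 * p)                       ≤⟨ *-mono-≤ (n≤1+n m) (image-lower-bound pr (below P≤p) 2^L≤p p<2^K) ⟩
    suc m * (4 * (L * L) * Mp)        ≡⟨ right (suc m) L Mp ⟩
    suc m * (2 * L) ^ 2 * Mp          ∎)
    where
    Mp : ℕ
    Mp = M p {{prime⇒nonZero pr}}
    left : ∀ m p → m * p * 9 ≡ m * (9 * p)
    left = solve-∀
    right : ∀ s L M → s * (4 * (L * L) * M) ≡ s * (2 * L * (2 * L * 1)) * M
    right = solve-∀
    log : LogLowerBound (2 * L) 3 p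
    log n = ≤-trans (expPartialScaled-2* L n) (*-monoˡ-≤ (n !) (begin
      8 ^ L           ≡⟨ ^-*-assoc 2 3 L ⟩
      2 ^ (3 * L)     ≡⟨ cong (2 ^_) (*-comm 3 L) ⟩
      2 ^ (L * 3)     ≡⟨ sym (^-*-assoc 2 L 3) ⟩
      (2 ^ L) ^ 3     ≤⟨ ^-monoˡ-≤ 3 2^L≤p ⟩
      p ^ 3           ∎))
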